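{- Let $P$ be an integer with $3\mid P$, and let $\delta\ge 1$ be an integer with $3^{\delta}\,\Vert\, P$ (so $P\neq 0$). Then the following hold. 1) Suppose $k\in\mathbb{N}$, $k\geq 2\delta-1$. Then for every residue $b$ modulo $3^k$, $$v_{u}(3^k,b)=\begin{cases}3^{\lfloor k/2\rfloor}, & \text{if }b\equiv u_{3^{2\lfloor(k-2\delta+1)/4\rfloor+1}}\pmod{3^k},\\ 2\cdot 3^l, &\text{if }b\equiv u_{3^{l-\delta}}\pmod{3^{2l+1}}\text{ for some }l\in\{\delta,\ldots,\lfloor(k-1)/2\rfloor\},\\ 1, &\text{if }b\equiv 0\pmod{3^\delta},\\ 0, &\text{otherwise,}\end{cases}$$ and $$v_{v}(3^k,b)=\begin{cases}3^{\lfloor k/2\rfloor}, & \text{if }b\equiv 2\pmod{3^k},\\ 2\cdot 3^l, &\text{if }b\equiv v_{2\cdot 3^{l-\delta}}\pmod{3^{2l+1}}\text{ for some }l\in\{\delta,\ldots,\lfloor(k-1)/2\rfloor\},\\ 1, &\text{if }b\equiv 0\pmod{3^{\delta}},\\ 0, &\text{otherwise.}\end{cases}$$ 2) Suppose $\delta\geq 2$ and $k\in\mathbb{N}$, $\delta\leq k<2\delta-1$. Then for every residue $b$ modulo $3^k$, $$v_{u}(3^k,b)=\begin{cases}3^{k-\delta}, & \text{if }b\equiv 1\pmod{3^k},\\ 1, &\text{if }b\equiv 0\pmod{3^{\delta}},\\ 0, &\text{otherwise,}\end{cases}$$ and $$v_{v}(3^k,b)=\begin{cases}3^{k-\delta},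 & \text{if }b\equiv 2\pmod{3^k},\\ 1, &\text{if }b\equiv 0\pmod{3^{\delta}},\\ 0, &\text{otherwise.}\end{cases}$$
   Context: For an integer $P$, the sequences $(u_n)$ and $(v_n)$ are defined by $u_0=0$, $u_1=1$, $u_n=Pu_{n-1}+u_{n-2}$ and $v_0=2$, $v_1=P$, $v_n=Pv_{n-1}+v_{n-2}$ for $n\ge 2$. For a prime $p$, $p^k\,\Vert\, n$ means that $p^k$ is the highest power of $p$ dividing $n$. $\mathbb{N}$ is the set of positive integers. For $m\in\mathbb{N}$, $h_u(m)$ (resp. $h_v(m)$) is the length of the shortest period of $(u_n)$ (resp. $(v_n)$) modulo $m$, i.e. the least positive integer $h$ with $u_{n+h}\equiv u_n \pmod m$ (resp. $v_{n+h}\equiv v_n\pmod m$) for all $n\ge 0$. For an integer $b$, the two-argument counting functions (not to be confused with the terms $v_n$) are $v_u(m,b)=\#\{n : 0\le n<h_u(m),\ u_n\equiv b\pmod m\}$ and $v_v(m,b)=\#\{n : 0\le n<h_v(m),\ v_n\equiv b\pmod m\}$. -}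

module Defs where

open import Data.Nat.Base as ℕ using (ℕ; zero; suc; NonZero; z≤n; s≤s; z<s)
import Data.Nat.Properties as ℕ
open import Data.Integer.Base using (ℤ; +_; _+_; _*_; _-_; _%ℕ_; _/ℕ_)
open import Data.Integer.DivMod using (n%ℕd<d; a≡a%ℕn+[a/ℕn]*n)
open import Data.Integer.Divisibility.Signed using (_∣_; divides; _∣?_; ∣m∣n⇒∣m+n; ∣m∣n⇒∣m-n; ∣n⇒∣m*n)
open import Data.Integer.Tactic.RingSolver using (solve-∀)
open import Data.Fin.Base using (Fin; toℕ; fromℕ<; combine)
open import Data.Fin.Properties using (pigeonhole; combine-injective; fromℕ<-injective)
open import Data.List.Base using (length; filter; upTo)
open import Data.Product.Base using (∃; ∃-syntax; _×_; _,_; proj₁; proj₂)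
open import Relation.Nullary using (¬_; Dec; yes; no; contradiction)
open import Relation.Nullary.Decidable using (_×-dec_)
open import Relation.Binary.PropositionalEquality

u : ℤ → ℕ → ℤ
u P zero          = + 0
u P (suc zero)    = + 1
u P (suc (suc n)) = P * u P (suc n) + u P n

v : ℤ → ℕ → ℤ
v P zero          = + 2
v P (suc zero)    = P
v P (suc (suc n)) = P * v P (suc n) + v P n

infix 4 _≡_[mod_] _≡?_[mod_] _^_∥_

_≡_[mod_] : ℤ → ℤ → ℕ → Set
a ≡ b [mod m ] = + m ∣ a - b

_≡?_[mod_] : ∀ a b m → Dec (a ≡ b [mod m ])
a ≡? b [mod m ] = + m ∣? (a - b)

_^_∥_ : ℕ → ℕ → ℤ → Set
p ^ k ∥ n = (+ (p ℕ.^ k) ∣ n) × ¬ (+ (p ℕ.^ suc k) ∣ n)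

IsPeriod : (ℕ → ℤ) → ℕ → ℕ → Set
IsPeriod s m h = ∀ n → s (n ℕ.+ h) ≡ s n [mod m ]

record IsShortestPeriod (s : ℕ → ℤ) (m h : ℕ) : Set where
  field
    positive : 0 ℕ.< h
    isPeriod : IsPeriod s m h
    minimal  : ∀ h′ → 0 ℕ.< h′ → IsPeriod s m h′ → h ℕ.≤ h′

-- Existence of the shortest period: two of the first m² + 1 pairs
-- (sₙ , sₙ₊₁) agree modulo m, and the recurrence can be run backwards.

private
  least : {Q : ℕ → Set} → (∀ n → Dec (Q n)) → ∀ n → Q n →
          ∃[ k ] (Q k × (∀ j → Q j → k ℕ.≤ j))
  least Q? zero    q = zero , q , λ _ _ → z≤n
  least {Q} Q? (suc n) q with Q? zero
  ... | yes q₀ = zero , q₀ , λ _ _ → z≤n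
  ... | no ¬q₀ with least (λ i → Q? (suc i)) n q
  ...   | k , qₖ , min = suc k , qₖ , min′
    where
    min′ : ∀ j → Q j → suc k ℕ.≤ j
    min′ zero    q₀ = contradiction q₀ ¬q₀
    min′ (suc j) qⱼ = s≤s (min j qⱼ)

  %ℕ-≡⇒≡mod : ∀ a b m .{{_ : NonZero m}} → a %ℕ m ≡ b %ℕ m → a ≡ b [mod m ]
  %ℕ-≡⇒≡mod a b m eq = divides (a /ℕ m - b /ℕ m) (begin
    a - b
      ≡⟨ cong₂ _-_ (a≡a%ℕn+[a/ℕn]*n a m) (a≡a%ℕn+[a/ℕn]*n b m) ⟩
    (+ (a %ℕ m) + a /ℕ m * + m) - (+ (b %ℕ m) + b /ℕ m * + m)
      ≡⟨ cong (λ r → (+ r + a /ℕ m * + m) - (+ (b %ℕ m) + b /ℕ m * + m)) eq ⟩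
    (+ (b %ℕ m) + a /ℕ m * + m) - (+ (b %ℕ m) + b /ℕ m * + m)
      ≡⟨ lemma (+ (b %ℕ m)) (a /ℕ m) (b /ℕ m) (+ m) ⟩
    (a /ℕ m - b /ℕ m) * + m ∎)
    where
    open ≡-Reasoning
    lemma : ∀ r q q′ n → (r + q * n) - (r + q′ * n) ≡ (q - q′) * n
    lemma = solve-∀

module _ (P : ℤ) (s : ℕ → ℤ) (rec : ∀ n → s (suc (suc n)) ≡ P * s (suc n) + s n)
         (m : ℕ) .{{_ : NonZero m}} where

  private
    Agree : ℕ → ℕ → Set
    Agree h n = (s (n ℕ.+ h) ≡ s n [mod m ]) × (s (suc n ℕ.+ h) ≡ s (suc n) [mod m ])

    forward : ∀ h n → Agree h n → Agree h (suc n)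
    forward h n (c₀ , c₁) = c₁ ,
      subst (+ m ∣_) (sym eq) (∣m∣n⇒∣m+n (∣n⇒∣m*n P c₁) c₀)
      where
      lemma : ∀ p x y x′ y′ → (p * x + y) - (p * x′ + y′) ≡ p * (x - x′) + (y - y′)
      lemma = solve-∀
      eq : s (suc (suc n) ℕ.+ h) - s (suc (suc n)) ≡
           P * (s (suc n ℕ.+ h) - s (suc n)) + (s (n ℕ.+ h) - s n)
      eq = trans (cong₂ _-_ (rec (n ℕ.+ h)) (rec n)) (lemma P _ _ _ _)

    backward : ∀ h n → Agree h (suc n) → Agree h n
    backward h n (c₁ , c₂) =
      subst (+ m ∣_) eq (∣m∣n⇒∣m-n c₂ (∣n⇒∣m*n P c₁)) , c₁
      where
      lemma : ∀ p x y x′ y′ →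
              ((p * x + y) - (p * x′ + y′)) - p * (x - x′) ≡ y - y′
      lemma = solve-∀
      eq : (s (suc (suc n) ℕ.+ h) - s (suc (suc n))) - P * (s (suc n ℕ.+ h) - s (suc n))
           ≡ s (n ℕ.+ h) - s n
      eq = trans (cong (_- P * (s (suc n ℕ.+ h) - s (suc n)))
                       (cong₂ _-_ (rec (n ℕ.+ h)) (rec n)))
                 (lemma P _ _ _ _)

    toStart : ∀ h n → Agree h n → Agree h 0
    toStart h zero    c = c
    toStart h (suc n) c = toStart h n (backward h n c)

    fromStart : ∀ h → Agree h 0 → ∀ n → Agree h n
    fromStart h c zero    = c
    fromStart h c (suc n) = forward h n (fromStart h c n)

    residue : ℕ → Fin m
    residue n = fromℕ< (n%ℕd<d (s n) m)

    residue-≡ : ∀ i j → residue i ≡ residue j → s i ≡ s j [mod m ]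
    residue-≡ i j eq = %ℕ-≡⇒≡mod (s i) (s j) m (fromℕ<-injective _ _ _ _ eq)

    statePair : Fin (suc (m ℕ.* m)) → Fin (m ℕ.* m)
    statePair i = combine (residue (toℕ i)) (residue (suc (toℕ i)))

    start : ∃[ h ] Agree (suc h) 0
    start with pigeonhole (ℕ.n<1+n _) statePair
    ... | i , j , i<j , eq
      with combine-injective (residue (toℕ j)) (residue (suc (toℕ j))) _ _ (sym eq)
    ...   | eq₀ , eq₁ = d , toStart (suc d) (toℕ i)
              ( residue-≡ (toℕ i ℕ.+ suc d) (toℕ i) (trans (cong residue i+1+d≡j) eq₀)
              , residue-≡ (suc (toℕ i ℕ.+ suc d)) (suc (toℕ i))
                          (trans (cong (λ x → residue (suc x)) i+1+d≡j) eq₁))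
      where
      d = toℕ j ℕ.∸ suc (toℕ i)
      i+1+d≡j : toℕ i ℕ.+ suc d ≡ toℕ j
      i+1+d≡j = trans (ℕ.+-suc (toℕ i) d) (ℕ.m+[n∸m]≡n i<j)

    agree? : ∀ h → Dec (Agree (suc h) 0)
    agree? h = (s (suc h) ≡? s 0 [mod m ]) ×-dec (s (suc (suc h)) ≡? s 1 [mod m ])

  shortestPeriod : ∃ (IsShortestPeriod s m)
  shortestPeriod with least agree? (proj₁ start) (proj₂ start)
  ... | h , agree , min = suc h , record
    { positive = z<s
    ; isPeriod = λ n → proj₁ (fromStart (suc h) agree n)
    ; minimal  = λ { (suc h′) _ per → s≤s (min h′ (per 0 , per 1)) }
    }

hᵤ : ℤ → (m : ℕ) .{{_ : NonZero m}} → ℕ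
hᵤ P m = proj₁ (shortestPeriod P (u P) (λ _ → refl) m)

hᵤ-isShortestPeriod : ∀ P m .{{_ : NonZero m}} → IsShortestPeriod (u P) m (hᵤ P m)
hᵤ-isShortestPeriod P m = proj₂ (shortestPeriod P (u P) (λ _ → refl) m)

hᵥ : ℤ → (m : ℕ) .{{_ : NonZero m}} → ℕ
hᵥ P m = proj₁ (shortestPeriod P (v P) (λ _ → refl) m)

hᵥ-isShortestPeriod : ∀ P m .{{_ : NonZero m}} → IsShortestPeriod (v P) m (hᵥ P m)
hᵥ-isShortestPeriod P m = proj₂ (shortestPeriod P (v P) (λ _ → refl) m)

-- The counting functions v_u(m, b) and v_v(m, b), written ν to keep them
-- apart from the sequence v.

νᵤ : ℤ → (m : ℕ) .{{_ : NonZero m}} → ℤ → ℕ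
νᵤ P m b = length (filter (λ n → u P n ≡? b [mod m ]) (upTo (hᵤ P m)))

νᵥ : ℤ → (m : ℕ) .{{_ : NonZero m}} → ℤ → ℕ
νᵥ P m b = length (filter (λ n → v P n ≡? b [mod m ]) (upTo (hᵥ P m)))

{-# OPTIONS --safe #-}
-- Split each sequence by the parity of the index.  Write a ~ b when a and b have the same
-- 3-adic valuation.  Lifting the exponent gives uₙ ~ P n for even n and vₙ ~ P n for odd n,
-- while the remaining terms are prime to 3.  The factorisations of sₙ₊₂ᵦ ∓ sₙ then show
--   uₘ - uₙ ~ 3^δ (m - n)     for m, n even,     uₘ - uₙ ~ 3^(2δ) (m² - n²)  for m, n odd,
-- and the same for v with the parities exchanged.  Hence the period modulo 3^k is
-- 2·3^(k-δ), each multiple of 3^δ is attained exactly once, and counting the other residues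
-- amounts to counting solutions of n² ≡ n₀² modulo 3^(k-2δ).
module Submission where

open import Defs
open import Data.Nat as ℕ using (ℕ; zero; suc; NonZero; z≤n; s≤s; _≤_; _<_)
import Data.Nat.Properties as ℕ
import Data.Nat.Divisibility as ℕ
import Data.Nat.DivMod as ℕ
open import Data.Nat.Induction using (<-rec)
open import Data.Nat.Primality using (prime?; euclidsLemma)
import Data.Nat.Tactic.RingSolver as ℕ-Solver
open import Data.Integer as ℤ using (ℤ; +_; _%ℕ_; _/ℕ_)
import Data.Integer.Properties as ℤ
open import Data.Integer.DivMod using (n%ℕd<d; a≡a%ℕn+[a/ℕn]*n)
open import Data.Integer.Divisibility.Signed
open import Data.Integer.Tactic.RingSolver using (solve-∀)
open import Data.Fin.Base using (Fin; zero; suc; toℕ; fromℕ<)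
open import Data.Fin.Properties using (pigeonhole; fromℕ<-injective; toℕ<n)
open import Data.List.Base using (length; filter; applyUpTo)
open import Data.Product using (_×_; _,_; proj₁; proj₂; ∃-syntax)
open import Data.Sum.Base as Sum using (_⊎_; inj₁; inj₂)
open import Relation.Nullary using (¬_; Dec; yes; no; contradiction)
open import Relation.Nullary.Decidable using (toWitness; _⊎-dec_)
open import Relation.Binary.Definitions using (tri<; tri≈; tri>)
open import Relation.Binary.PropositionalEquality

-- A relation `~` takes the place of a valuation function because the differences compared may be 0;
-- unit multipliers certify equal valuations without any division. In the half whose terms are prime
-- to 3, residues are governed by 3^(2δ) n² modulo 3^k, n being the index. All n for which this
-- vanishes share one residue. Otherwise n = 3^e m with m prime to 3; since m² ≡ 1 modulo 3, the
-- term modulo 3^(2δ+2e+1) depends on e alone. With l = δ + e this is the modulus 3^(2l+1) of the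
-- statement. Conversely, a residue prescribed only modulo 3^(2l+1) must be shown to occur modulo
-- 3^k. Hensel lifting is replaced by the pigeonhole principle: 3^g suitable indices have pairwise
-- distinct values among 3^g admissible residues. Finally n² has the two roots n and -n, each
-- determined modulo 3^(k-2δ-e), so that 2·3^l of the 3^(k-δ) indices share the residue.

-- Divisibility by powers of 3, and pigeonhole arguments

module ThreeAdic where
  open import Data.Integer.Base using (-_; _+_; _*_; _-_)

  infix 9 3^_
  3^_ : ℕ → ℤ
  3^ i = + (3 ℕ.^ i)

  3^-+ : ∀ i j → 3^ (i ℕ.+ j) ≡ 3^ i * 3^ j
  3^-+ i j = trans (cong +_ (ℕ.^-distribˡ-+-* 3 i j)) (ℤ.pos-* (3 ℕ.^ i) (3 ℕ.^ j))

  3^-suc : ∀ i → 3^ (suc i) ≡ + 3 * 3^ i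
  3^-suc i = ℤ.pos-* 3 (3 ℕ.^ i)

  3^-mono-∣ : ∀ {i j} → i ℕ.≤ j → 3^ i ∣ 3^ j
  3^-mono-∣ {i} {j} i≤j = divides (3^ (j ℕ.∸ i))
    (trans (cong 3^_ (sym (ℕ.m∸n+n≡m i≤j))) (3^-+ (j ℕ.∸ i) i))

  3∣3^suc : ∀ i → + 3 ∣ 3^ (suc i)
  3∣3^suc i = 3^-mono-∣ {1} {suc i} (s≤s z≤n)

  3^0∣ : ∀ a → 3^ 0 ∣ a
  3^0∣ a = divides a (sym (ℤ.*-identityʳ a))

  3^-*-mono-∣ : ∀ i j {a} → 3^ j ∣ a → 3^ (i ℕ.+ j) ∣ 3^ i * a
  3^-*-mono-∣ i j {a} d = subst (_∣ 3^ i * a) (sym (3^-+ i j)) (*-monoʳ-∣ (3^ i) d)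

  3^-*-cancel-∣ : ∀ i j {a} → 3^ (i ℕ.+ j) ∣ 3^ i * a → 3^ j ∣ a
  3^-*-cancel-∣ i j {a} d = *-cancelˡ-∣ (3^ i) {{ℕ.m^n≢0 3 i}} (subst (_∣ 3^ i * a) (3^-+ i j) d)

  euclid : ∀ a b → + 3 ∣ a * b → + 3 ∣ a ⊎ + 3 ∣ b
  euclid a b d with euclidsLemma ℤ.∣ a ∣ ℤ.∣ b ∣ (toWitness {a? = prime? 3} _)
                      (subst (3 ℕ.∣_) (ℤ.abs-* a b) (∣⇒∣ᵤ d))
  ... | inj₁ e = inj₁ (∣ᵤ⇒∣ e)
  ... | inj₂ e = inj₂ (∣ᵤ⇒∣ e)

  Unit : ℤ → Set
  Unit a = ¬ (+ 3 ∣ a)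

  unit-* : ∀ {a b} → Unit a → Unit b → Unit (a * b)
  unit-* {a} {b} ua ub d with euclid a b d
  ... | inj₁ e = ua e
  ... | inj₂ e = ub e

  unit-+3* : ∀ {a} t → Unit a → Unit (a + + 3 * t)
  unit-+3* t ua d = ua (∣m+n∣n⇒∣m d (∣m⇒∣m*n t ∣-refl))

  unit-1 : Unit (+ 1)
  unit-1 d with ℕ.∣⇒≤ (∣⇒∣ᵤ d)
  ... | s≤s ()

  unit-2 : Unit (+ 2)
  unit-2 d with ℕ.∣⇒≤ (∣⇒∣ᵤ d)
  ... | s≤s (s≤s ())

  -- Euclid's lemma hands the factors 3 of the product to `a`, one at a time.
  unit-cancel-∣ : ∀ i {r a} → Unit r → 3^ i ∣ r * a → 3^ i ∣ a
  unit-cancel-∣ zero    {a = a} ur d = 3^0∣ a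
  unit-cancel-∣ (suc i) {r} {a} ur d with euclid r a (∣-trans (3∣3^suc i) d)
  ... | inj₁ e = contradiction e ur
  ... | inj₂ (divides q refl) = subst (3^ (suc i) ∣_) (ℤ.*-comm (+ 3) q)
    (3^-*-mono-∣ 1 i (unit-cancel-∣ i ur (3^-*-cancel-∣ 1 i (subst (3^ (suc i) ∣_) (lemma r q) d))))
    where
    lemma : ∀ r q → r * (q * + 3) ≡ + 3 * (r * q)
    lemma = solve-∀

  -- a ~ b expresses that a and b have the same 3-adic valuation, possibly infinite.
  infix 4 _~_
  record _~_ (a b : ℤ) : Set where
    constructor mk~
    field
      r s    : ℤ
      r-unit : Unit r
      s-unit : Unit s
      eq     : r * a ≡ s * b

  ~-refl : ∀ {a} → a ~ a
  ~-refl = mk~ (+ 1) (+ 1) unit-1 unit-1 refl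

  ~-reflexive : ∀ {a b} → a ≡ b → a ~ b
  ~-reflexive refl = ~-refl

  ~-sym : ∀ {a b} → a ~ b → b ~ a
  ~-sym (mk~ r s ur us eq) = mk~ s r us ur (sym eq)

  ~-trans : ∀ {a b c} → a ~ b → b ~ c → a ~ c
  ~-trans {a} {b} {c} (mk~ r s ur us eq) (mk~ r′ s′ ur′ us′ eq′) =
    mk~ (r * r′) (s * s′) (unit-* ur ur′) (unit-* us us′) (begin
      r * r′ * a    ≡⟨ rearrange r r′ a ⟩
      r′ * (r * a)  ≡⟨ cong (r′ *_) eq ⟩
      r′ * (s * b)  ≡⟨ swap r′ s b ⟩
      s * (r′ * b)  ≡⟨ cong (s *_) eq′ ⟩
      s * (s′ * c)  ≡⟨ ℤ.*-assoc s s′ c ⟨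
      s * s′ * c    ∎)
    where
    open ≡-Reasoning
    rearrange : ∀ r r′ a → r * r′ * a ≡ r′ * (r * a)
    rearrange = solve-∀
    swap : ∀ r s b → r * (s * b) ≡ s * (r * b)
    swap = solve-∀

  ~-* : ∀ {a b c d} → a ~ b → c ~ d → a * c ~ b * d
  ~-* {a} {b} {c} {d} (mk~ r s ur us eq) (mk~ r′ s′ ur′ us′ eq′) =
    mk~ (r * r′) (s * s′) (unit-* ur ur′) (unit-* us us′)
      (trans (interchange r r′ a c) (trans (cong₂ _*_ eq eq′) (sym (interchange s s′ b d))))
    where
    interchange : ∀ r s a b → r * s * (a * b) ≡ r * a * (s * b)
    interchange = solve-∀

  unit-*-~ : ∀ {r} a → Unit r → r * a ~ a
  unit-*-~ {r} a ur = mk~ (+ 1) r unit-1 ur (ℤ.*-identityˡ (r * a))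

  ~-neg : ∀ {a b} → a ~ b → - a ~ - b
  ~-neg {a} {b} (mk~ r s ur us eq) = mk~ r s ur us
    (trans (sym (ℤ.neg-distribʳ-* r a)) (trans (cong -_ eq) (ℤ.neg-distribʳ-* s b)))

  -- Divisibility by powers of 3 is the only information ever extracted from `~`.
  ~-∣ : ∀ i {a b} → a ~ b → 3^ i ∣ a → 3^ i ∣ b
  ~-∣ i (mk~ r s ur us eq) d = unit-cancel-∣ i us (subst (3^ i ∣_) eq (∣n⇒∣m*n r d))

  -- A valuation truncated at `f`: the bound drives the recursion and makes `n = 0` an ordinary
  -- case.
  ∣-or-factor : ∀ f n → 3^ f ∣ n ⊎ ∃[ e ] ∃[ m ] (e ℕ.< f × n ≡ 3^ e * m × Unit m)
  ∣-or-factor zero    n = inj₁ (3^0∣ n)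
  ∣-or-factor (suc f) n with + 3 ∣? n
  ... | no un = inj₂ (0 , n , s≤s z≤n , sym (ℤ.*-identityˡ n) , un)
  ... | yes (divides q refl) with ∣-or-factor f q
  ...   | inj₁ d = inj₁ (subst (3^ (suc f) ∣_) (ℤ.*-comm (+ 3) q) (3^-*-mono-∣ 1 f d))
  ...   | inj₂ (e , m , e<f , refl , um) = inj₂ (suc e , m , s≤s e<f ,
            trans (ℤ.*-comm (3^ e * m) (+ 3)) (trans (sym (ℤ.*-assoc (+ 3) (3^ e) m))
              (cong (_* m) (sym (3^-suc e)))) , um)

  -- A square has even valuation, so `2a - 1` factors 3 in `m * m` already give `2a` of them. The
  -- recursion takes one 3 from `m` and two from the square.
  square-∣ : ∀ a k m → a ℕ.+ a ℕ.≤ suc k → 3^ k ∣ m * m → 3^ a ∣ m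
  square-∣ zero    k m le d = 3^0∣ m
  square-∣ (suc a) zero m (s≤s le) d = contradiction (subst (ℕ._≤ 0) (ℕ.+-suc a a) le) λ ()
  square-∣ (suc a) (suc k) m (s≤s le) d with + 3 ∣? m
  ... | no um = contradiction (∣-trans (3∣3^suc k) d) (unit-* um um)
  square-∣ (suc zero) (suc zero) m le d | yes e = e
  square-∣ (suc (suc a)) (suc zero) m (s≤s (s≤s le)) d | yes e =
    contradiction (subst (ℕ._≤ 0) (ℕ.+-suc a (suc a)) le) λ ()
  square-∣ (suc a) (suc (suc k)) m (s≤s le) d | yes (divides q refl) =
    subst (3^ (suc a) ∣_) (ℤ.*-comm (+ 3) q) (3^-*-mono-∣ 1 a
      (square-∣ a k q (ℕ.≤-pred (subst (ℕ._≤ suc (suc k)) (ℕ.+-suc a a) le))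
        (3^-*-cancel-∣ 2 k (subst (3^ (2 ℕ.+ k) ∣_) (lemma q) d))))
    where
    lemma : ∀ q → q * + 3 * (q * + 3) ≡ + 9 * (q * q)
    lemma = solve-∀

  <⇒∤-difference : ∀ {N x y} → x ℕ.< y → y ℕ.< N → ¬ (+ N ∣ + y - + x)
  <⇒∤-difference {N} {x} {y} x<y y<N d = ℕ.<⇒≱ (ℕ.≤-<-trans (ℕ.m∸n≤m y x) y<N)
    (ℕ.∣⇒≤ {{ℕ.>-nonZero (ℕ.m<n⇒0<n∸m x<y)}} (subst (λ z → N ℕ.∣ ℤ.∣ z ∣) eq (∣⇒∣ᵤ d)))
    where
    eq : + y - + x ≡ + (y ℕ.∸ x)
    eq = trans (ℤ.m-n≡m⊖n y x) (ℤ.⊖-≥ (ℕ.<⇒≤ x<y))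

  difference-cancel : ∀ x y r → (x - r) - (y - r) ≡ x - y
  difference-cancel = solve-∀

  ∣-swap : ∀ {N} a b → N ∣ a - b → N ∣ b - a
  ∣-swap {N} a b d = subst (N ∣_) (lemma a b) (∣m⇒∣-m d)
    where
    lemma : ∀ a b → - (a - b) ≡ b - a
    lemma = solve-∀

  ∣-difference⇒≡ : ∀ {N x y} → x ℕ.< N → y ℕ.< N → + N ∣ + x - + y → x ≡ y
  ∣-difference⇒≡ {N} {x} {y} x<N y<N d with ℕ.<-cmp x y
  ... | tri< x<y _ _ = contradiction (∣-swap (+ x) (+ y) d) (<⇒∤-difference x<y y<N)
  ... | tri≈ _ x≡y _ = x≡y
  ... | tri> _ _ y<x = contradiction d (<⇒∤-difference y<x x<N)

  -- Either 0 collides with a value of f modulo N, or two values of f collide.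
  injective⇒hits-0 : ∀ N .{{_ : NonZero N}} (f : ℕ → ℤ) →
    (∀ x y → + N ∣ f x - f y → + N ∣ + x - + y) → ∃[ x ] (x ℕ.< N × + N ∣ f x)
  injective⇒hits-0 N f inj = find (pigeonhole (ℕ.n<1+n N) residue)
    where
    value : Fin (suc N) → ℤ
    value zero    = + 0
    value (suc i) = f (toℕ i)
    residue : Fin (suc N) → Fin N
    residue i = fromℕ< (n%ℕd<d (value i) N)
    congruent : ∀ i j → residue i ≡ residue j → + N ∣ value i - value j
    congruent i j eq = divides (value i /ℕ N - value j /ℕ N) (begin
      value i - value j
        ≡⟨ cong₂ _-_ (a≡a%ℕn+[a/ℕn]*n (value i) N) (a≡a%ℕn+[a/ℕn]*n (value j) N) ⟩
      (+ (value i %ℕ N) + value i /ℕ N * + N) - (+ (value j %ℕ N) + value j /ℕ N * + N)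
        ≡⟨ cong (λ r → (+ r + value i /ℕ N * + N) - (+ (value j %ℕ N) + value j /ℕ N * + N))
             (fromℕ<-injective _ _ _ _ eq) ⟩
      (+ (value j %ℕ N) + value i /ℕ N * + N) - (+ (value j %ℕ N) + value j /ℕ N * + N)
        ≡⟨ lemma (+ (value j %ℕ N)) (value i /ℕ N) (value j /ℕ N) (+ N) ⟩
      (value i /ℕ N - value j /ℕ N) * + N ∎)
      where
      open ≡-Reasoning
      lemma : ∀ r q q′ n → (r + q * n) - (r + q′ * n) ≡ (q - q′) * n
      lemma = solve-∀
    find : ∃[ i ] ∃[ j ] (toℕ i ℕ.< toℕ j × residue i ≡ residue j) → ∃[ x ] (x ℕ.< N × + N ∣ f x)
    find (i , zero , () , eq)
    find (zero , suc j , _ , eq) = toℕ j , toℕ<n j ,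
      subst (+ N ∣_) (ℤ.+-identityʳ (f (toℕ j))) (congruent (suc j) zero (sym eq))
    find (suc i , suc j , s≤s i<j , eq) =
      contradiction (inj (toℕ j) (toℕ i) (congruent (suc j) (suc i) (sym eq)))
        (<⇒∤-difference i<j (toℕ<n j))

  -- The substitute for Hensel lifting. Dividing `F x - b` by `3^ L` leaves a map that is injective
  -- modulo `3^ g`, and by pigeonhole such a map takes the value 0.
  injective⇒surjective : ∀ L g (F : ℕ → ℤ) b → (∀ x → 3^ L ∣ F x - b) →
    (∀ x y → 3^ (L ℕ.+ g) ∣ F x - F y → 3^ g ∣ + x - + y) →
    ∃[ x ] (x ℕ.< 3 ℕ.^ g × 3^ (L ℕ.+ g) ∣ F x - b)
  injective⇒surjective L g F b div inj = conclude
    (injective⇒hits-0 (3 ℕ.^ g) {{ℕ.m^n≢0 3 g}} quot quot-injective)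
    where
    quot : ℕ → ℤ
    quot x = _∣_.quotient (div x)
    div-eq : ∀ x → F x - b ≡ quot x * 3^ L
    div-eq x = _∣_.equality (div x)
    lemma : ∀ t q q′ → q * t - q′ * t ≡ t * (q - q′)
    lemma = solve-∀
    eq : ∀ x y → F x - F y ≡ 3^ L * (quot x - quot y)
    eq x y = trans (sym (difference-cancel (F x) (F y) b))
      (trans (cong₂ _-_ (div-eq x) (div-eq y)) (lemma (3^ L) (quot x) (quot y)))
    quot-injective : ∀ x y → 3^ g ∣ quot x - quot y → 3^ g ∣ + x - + y
    quot-injective x y d = inj x y (subst (3^ (L ℕ.+ g) ∣_) (sym (eq x y)) (3^-*-mono-∣ L g d))
    conclude : ∃[ x ] (x ℕ.< 3 ℕ.^ g × 3^ g ∣ quot x) →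
      ∃[ x ] (x ℕ.< 3 ℕ.^ g × 3^ (L ℕ.+ g) ∣ F x - b)
    conclude (x , x<n , d) = x , x<n , subst (3^ (L ℕ.+ g) ∣_)
      (trans (ℤ.*-comm (3^ L) (quot x)) (sym (div-eq x))) (3^-*-mono-∣ L g d)

  residue-exists : ∀ N .{{_ : NonZero N}} a → ∃[ x ] (x ℕ.< N × + N ∣ + x - a)
  residue-exists N a = injective⇒hits-0 N (λ x → + x - a)
    (λ x y → subst (+ N ∣_) (difference-cancel (+ x) (+ y) a))

-- Counting the solutions of a decidable predicate

module Counting where
  open import Data.Nat.Base using (_+_; _*_)
  open ThreeAdic

  indicator : {A : Set} → Dec A → ℕ
  indicator (yes _) = 1
  indicator (no _)  = 0

  -- Shifting the predicate, instead of descending from `n`, follows the unfolding of `applyUpTo`,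
  -- of which `upTo` is an instance.
  count : {Q : ℕ → Set} → (∀ n → Dec (Q n)) → ℕ → ℕ
  count Q? zero    = 0
  count Q? (suc n) = indicator (Q? 0) + count (λ i → Q? (suc i)) n

  length-filter-applyUpTo : {Q : ℕ → Set} (Q? : ∀ n → Dec (Q n)) (f : ℕ → ℕ) (n : ℕ) →
    length (filter Q? (applyUpTo f n)) ≡ count (λ i → Q? (f i)) n
  length-filter-applyUpTo Q? f zero = refl
  length-filter-applyUpTo Q? f (suc n) with Q? (f 0)
  ... | yes _ = cong suc (length-filter-applyUpTo Q? (λ i → f (suc i)) n)
  ... | no _  = length-filter-applyUpTo Q? (λ i → f (suc i)) n

  indicator-cong : {A B : Set} (a? : Dec A) (b? : Dec B) → (A → B) → (B → A) →
    indicator a? ≡ indicator b?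
  indicator-cong (yes _) (yes _) f g = refl
  indicator-cong (yes a) (no ¬b) f g = contradiction (f a) ¬b
  indicator-cong (no ¬a) (yes b) f g = contradiction (g b) ¬a
  indicator-cong (no _)  (no _)  f g = refl

  count-cong : {Q R : ℕ → Set} (Q? : ∀ n → Dec (Q n)) (R? : ∀ n → Dec (R n)) →
    (∀ n → Q n → R n) → (∀ n → R n → Q n) → ∀ n → count Q? n ≡ count R? n
  count-cong Q? R? f g zero    = refl
  count-cong Q? R? f g (suc n) = cong₂ _+_ (indicator-cong (Q? 0) (R? 0) (f 0) (g 0))
    (count-cong (λ i → Q? (suc i)) (λ i → R? (suc i)) (λ i → f (suc i)) (λ i → g (suc i)) n)

  count-none : {Q : ℕ → Set} (Q? : ∀ n → Dec (Q n)) → ∀ n →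
    (∀ x → x ℕ.< n → ¬ Q x) → count Q? n ≡ 0
  count-none Q? zero    none = refl
  count-none Q? (suc n) none with Q? 0
  ... | yes q = contradiction q (none 0 (s≤s z≤n))
  ... | no _  = count-none (λ i → Q? (suc i)) n (λ x x<n → none (suc x) (s≤s x<n))

  count-unique : {Q : ℕ → Set} (Q? : ∀ n → Dec (Q n)) → ∀ n x → x ℕ.< n → Q x →
    (∀ y → y ℕ.< n → Q y → y ≡ x) → count Q? n ≡ 1
  count-unique Q? (suc n) zero (s≤s x<n) q unique with Q? 0
  ... | no ¬q = contradiction q ¬q
  ... | yes _ = cong suc (count-none (λ i → Q? (suc i)) n
                  (λ y y<n q′ → contradiction (unique (suc y) (s≤s y<n) q′) λ ()))
  count-unique Q? (suc n) (suc x) (s≤s x<n) q unique with Q? 0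
  ... | yes q₀ = contradiction (unique 0 (s≤s z≤n) q₀) λ ()
  ... | no _   = count-unique (λ i → Q? (suc i)) n x x<n q
                   (λ y y<n q′ → ℕ.suc-injective (unique (suc y) (s≤s y<n) q′))

  count-⊎ : {Q R : ℕ → Set} (Q? : ∀ n → Dec (Q n)) (R? : ∀ n → Dec (R n)) →
    (∀ n → Q n → ¬ R n) → ∀ n → count (λ i → Q? i ⊎-dec R? i) n ≡ count Q? n + count R? n
  count-⊎ Q? R? disjoint zero    = refl
  count-⊎ Q? R? disjoint (suc n)
    with count-⊎ (λ i → Q? (suc i)) (λ i → R? (suc i)) (λ i → disjoint (suc i)) n | Q? 0 | R? 0
  ... | ih | yes q | yes r = contradiction r (disjoint 0 q)
  ... | ih | yes q | no ¬r = cong suc ih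
  ... | ih | no ¬q | yes r = trans (cong suc ih) (sym (ℕ.+-suc _ _))
  ... | ih | no ¬q | no ¬r = ih

  count-+ : {Q : ℕ → Set} (Q? : ∀ n → Dec (Q n)) → ∀ m n →
    count Q? (m + n) ≡ count Q? m + count (λ i → Q? (m + i)) n
  count-+ Q? zero    n = refl
  count-+ Q? (suc m) n = trans (cong (λ c → indicator (Q? 0) + c) (count-+ (λ i → Q? (suc i)) m n))
    (sym (ℕ.+-assoc (indicator (Q? 0)) _ _))

  parity : ∀ n → ∃[ c ] (n ≡ c * 2 ⊎ n ≡ suc (c * 2))
  parity zero = 0 , inj₁ refl
  parity (suc n) with parity n
  ... | c , inj₁ refl = c , inj₂ refl
  ... | c , inj₂ refl = suc c , inj₁ refl

  count-parity : {Q : ℕ → Set} (Q? : ∀ n → Dec (Q n)) → ∀ n →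
    count Q? (n * 2) ≡ count (λ i → Q? (i * 2)) n + count (λ i → Q? (suc (i * 2))) n
  count-parity Q? zero    = refl
  count-parity Q? (suc n) = trans
    (cong (λ c → indicator (Q? 0) + (indicator (Q? 1) + c)) (count-parity (λ i → Q? (suc (suc i))) n))
    (rearrange (indicator (Q? 0)) (indicator (Q? 1)) _ _)
    where
    rearrange : ∀ a b c d → a + (b + (c + d)) ≡ (a + c) + (b + d)
    rearrange = ℕ-Solver.solve-∀

  count-period : ∀ M .{{_ : NonZero M}} r → count (λ x → + M ∣? (+ x ℤ.- r)) M ≡ 1
  count-period M r with residue-exists M r
  ... | x , x<M , d = count-unique _ M x x<M d (λ y y<M e → ∣-difference⇒≡ y<M x<M
          (subst (+ M ∣_) (difference-cancel (+ y) (+ x) r) (∣m∣n⇒∣m-n e d)))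

  -- Each block of `M` consecutive numbers meets the class once. The representative `r` is an
  -- integer so that it can be lowered by `M` for the next block, and so that mirrored classes with
  -- negative `r` are covered.
  count-residue-class : ∀ M .{{_ : NonZero M}} N r → count (λ x → + M ∣? (+ x ℤ.- r)) (N * M) ≡ N
  count-residue-class M zero    r = refl
  count-residue-class M (suc N) r = trans (count-+ (λ x → + M ∣? (+ x ℤ.- r)) M (N * M))
    (cong₂ _+_ (count-period M r) (trans
      (count-cong _ (λ x → + M ∣? (+ x ℤ.- (r ℤ.- + M)))
        (λ x → subst (+ M ∣_) (shift x)) (λ x → subst (+ M ∣_) (sym (shift x))) (N * M))
      (count-residue-class M N (r ℤ.- + M))))
    where
    lemma : ∀ m x r → (m ℤ.+ x) ℤ.- r ≡ x ℤ.- (r ℤ.- m)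
    lemma = solve-∀
    shift : ∀ x → + (M + x) ℤ.- r ≡ + x ℤ.- (r ℤ.- + M)
    shift x = lemma (+ M) (+ x) r

-- Identities for the sequences u and v

module Lucas (P : ℤ) where
  open import Data.Integer.Base using (-_; _+_; _*_; _-_)
  open ThreeAdic
  open Counting using (parity)

  private
    U V : ℕ → ℤ
    U = u P
    V = v P

  -- The sign (-1)^n, that is (αβ)^n for the roots α, β of X² = P X + 1.
  σ : ℕ → ℤ
  σ zero    = + 1
  σ (suc n) = - σ n

  σ-even : ∀ c → σ (c ℕ.* 2) ≡ + 1
  σ-even zero    = refl
  σ-even (suc c) = cong (λ z → - - z) (σ-even c)

  σ-odd : ∀ c → σ (suc (c ℕ.* 2)) ≡ - + 1
  σ-odd c = cong -_ (σ-even c)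

  -- Cassini's identity with u_(n-1) written as u_(n+1) - P u_n, which avoids predecessors of
  -- indices.
  cassini : ∀ n → U (suc n) * U (suc n) - P * U (suc n) * U n - U n * U n ≡ σ n
  cassini zero    = lemma P
    where
    lemma : ∀ P → + 1 * + 1 - P * + 1 * + 0 - + 0 * + 0 ≡ + 1
    lemma = solve-∀
  cassini (suc n) = trans (lemma P (U n) (U (suc n))) (cong -_ (cassini n))
    where
    lemma : ∀ P x y → (P * y + x) * (P * y + x) - P * (P * y + x) * y - y * y
                    ≡ - (y * y - P * y * x - x * x)
    lemma = solve-∀

  -- This is v_n = u_(n+1) + u_(n-1) with the same elimination of u_(n-1); `u-via-v` is its dual,
  -- with the discriminant P² + 4.
  v-via-u : ∀ n → V n ≡ + 2 * U (suc n) - P * U n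
  v-via-u zero          = lemma P
    where
    lemma : ∀ P → + 2 ≡ + 2 * + 1 - P * + 0
    lemma = solve-∀
  v-via-u (suc zero)    = lemma P
    where
    lemma : ∀ P → P ≡ + 2 * (P * + 1 + + 0) - P * + 1
    lemma = solve-∀
  v-via-u (suc (suc n)) = trans (cong₂ (λ x y → P * x + y) (v-via-u (suc n)) (v-via-u n))
    (lemma P (U n) (U (suc n)))
    where
    lemma : ∀ P x y → P * (+ 2 * (P * y + x) - P * y) + (+ 2 * y - P * x)
                    ≡ + 2 * (P * (P * y + x) + y) - P * (P * y + x)
    lemma = solve-∀

  u-via-v : ∀ n → + 2 * V (suc n) - P * V n ≡ (P * P + + 4) * U n
  u-via-v n = trans (cong₂ (λ x y → + 2 * x - P * y) (v-via-u (suc n)) (v-via-u n))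
    (lemma P (U n) (U (suc n)))
    where
    lemma : ∀ P x y → + 2 * (+ 2 * (P * y + x) - P * y) - P * (+ 2 * y - P * x) ≡ (P * P + + 4) * x
    lemma = solve-∀

  module Recurrence (s : ℕ → ℤ) (rec : ∀ n → s (suc (suc n)) ≡ P * s (suc n) + s n) where

    -- The addition formula s_(n+b) = s_n u_(b-1) + s_(n+1) u_b. The bracket is u_(b-1), also for
    -- `b = 0`, where it gives u_(-1) = 1.
    shift : ∀ n b → s (n ℕ.+ b) ≡ s n * (U (suc b) - P * U b) + s (suc n) * U b
    shift n zero    = trans (cong s (ℕ.+-identityʳ n)) (lemma P (s n) (s (suc n)))
      where
      lemma : ∀ P x y → x ≡ x * (+ 1 - P * + 0) + y * + 0
      lemma = solve-∀
    shift n (suc b) = begin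
      s (n ℕ.+ suc b)
        ≡⟨ cong s (ℕ.+-suc n b) ⟩
      s (suc n ℕ.+ b)
        ≡⟨ shift (suc n) b ⟩
      s (suc n) * (U (suc b) - P * U b) + s (suc (suc n)) * U b
        ≡⟨ cong (λ z → s (suc n) * (U (suc b) - P * U b) + z * U b) (rec n) ⟩
      s (suc n) * (U (suc b) - P * U b) + (P * s (suc n) + s n) * U b
        ≡⟨ lemma P (s n) (s (suc n)) (U b) (U (suc b)) ⟩
      s n * (P * U (suc b) + U b - P * U (suc b)) + s (suc n) * U (suc b) ∎
      where
      open ≡-Reasoning
      lemma : ∀ P x y p q → y * (q - P * p) + (P * y + x) * p ≡ x * (P * q + p - P * q) + y * q
      lemma = solve-∀

    private
      shift-suc : ∀ n b → s (suc (n ℕ.+ b)) ≡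
        s (suc n) * (U (suc b) - P * U b) + (P * s (suc n) + s n) * U b
      shift-suc n b = trans (shift (suc n) b)
        (cong (λ z → s (suc n) * (U (suc b) - P * U b) + z * U b) (rec n))

    -- Replacing `σ b` by the quadratic form of `cassini` makes both sides polynomials in `s n`,
    -- `s (suc n)`, `U b` and `U (suc b)`.
    symmetric-sum : ∀ n b → s (n ℕ.+ b ℕ.+ b) + σ b * s n ≡ s (n ℕ.+ b) * V b
    symmetric-sum n b = begin
      s (n ℕ.+ b ℕ.+ b) + σ b * s n
        ≡⟨ cong₂ _+_ (shift (n ℕ.+ b) b) (cong (_* s n) (sym (cassini b))) ⟩
      s (n ℕ.+ b) * (q - P * p) + s (suc (n ℕ.+ b)) * p + (q * q - P * q * p - p * p) * x
        ≡⟨ cong₂ (λ z z′ → z * (q - P * p) + z′ * p + (q * q - P * q * p - p * p) * x)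
             (shift n b) (shift-suc n b) ⟩
      (x * (q - P * p) + y * p) * (q - P * p) + (y * (q - P * p) + (P * y + x) * p) * p
        + (q * q - P * q * p - p * p) * x
        ≡⟨ lemma P x y p q ⟩
      (x * (q - P * p) + y * p) * (+ 2 * q - P * p)
        ≡⟨ cong₂ _*_ (sym (shift n b)) (sym (v-via-u b)) ⟩
      s (n ℕ.+ b) * V b ∎
      where
      open ≡-Reasoning
      x = s n
      y = s (suc n)
      p = U b
      q = U (suc b)
      lemma : ∀ P x y p q →
        (x * (q - P * p) + y * p) * (q - P * p) + (y * (q - P * p) + (P * y + x) * p) * p
          + (q * q - P * q * p - p * p) * x
        ≡ (x * (q - P * p) + y * p) * (+ 2 * q - P * p)
      lemma = solve-∀

    -- The bracket is s_(n+b+1) + s_(n+b-1), the companion of s: it is v_(n+b) for s = u and (P² +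
    -- 4) u_(n+b) for s = v.
    symmetric-difference : ∀ n b → s (n ℕ.+ b ℕ.+ b) - σ b * s n ≡
      (+ 2 * s (suc (n ℕ.+ b)) - P * s (n ℕ.+ b)) * U b
    symmetric-difference n b = begin
      s (n ℕ.+ b ℕ.+ b) - σ b * s n
        ≡⟨ lemma₁ (s (n ℕ.+ b ℕ.+ b)) (σ b * s n) ⟩
      s (n ℕ.+ b ℕ.+ b) + σ b * s n - + 2 * (σ b * s n)
        ≡⟨ cong₂ (λ z z′ → z - + 2 * (z′ * s n)) (symmetric-sum n b) (sym (cassini b)) ⟩
      s (n ℕ.+ b) * V b - + 2 * ((q * q - P * q * p - p * p) * x)
        ≡⟨ cong₂ (λ z z′ → z * z′ - + 2 * ((q * q - P * q * p - p * p) * x)) (shift n b) (v-via-u b) ⟩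
      (x * (q - P * p) + y * p) * (+ 2 * q - P * p) - + 2 * ((q * q - P * q * p - p * p) * x)
        ≡⟨ lemma₂ P x y p q ⟩
      (+ 2 * (y * (q - P * p) + (P * y + x) * p) - P * (x * (q - P * p) + y * p)) * p
        ≡⟨ cong₂ (λ z z′ → (+ 2 * z - P * z′) * p) (sym (shift-suc n b)) (sym (shift n b)) ⟩
      (+ 2 * s (suc (n ℕ.+ b)) - P * s (n ℕ.+ b)) * U b ∎
      where
      open ≡-Reasoning
      x = s n
      y = s (suc n)
      p = U b
      q = U (suc b)
      lemma₁ : ∀ a b → a - b ≡ a + b - + 2 * b
      lemma₁ = solve-∀
      lemma₂ : ∀ P x y p q →
        (x * (q - P * p) + y * p) * (+ 2 * q - P * p) - + 2 * ((q * q - P * q * p - p * p) * x)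
        ≡ (+ 2 * (y * (q - P * p) + (P * y + x) * p) - P * (x * (q - P * p) + y * p)) * p
      lemma₂ = solve-∀

    -- The sign `σ b` decides which symmetric identity has the plain difference on its left: the one
    -- with `U b` for even `b`, the one with `V b` for odd `b`.
    even-step : ∀ n b d → b ≡ d ℕ.* 2 →
      s (n ℕ.+ b ℕ.+ b) - s n ≡ (+ 2 * s (suc (n ℕ.+ b)) - P * s (n ℕ.+ b)) * U b
    even-step n b d refl = trans
      (cong (λ z → s (n ℕ.+ b ℕ.+ b) - z) (sym (trans (cong (_* s n) (σ-even d)) (ℤ.*-identityˡ (s n)))))
      (symmetric-difference n b)

    odd-step : ∀ n b d → b ≡ suc (d ℕ.* 2) → s (n ℕ.+ b ℕ.+ b) - s n ≡ s (n ℕ.+ b) * V b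
    odd-step n b d refl = trans
      (cong (λ z → s (n ℕ.+ b ℕ.+ b) + z) (sym (trans (cong (_* s n) (σ-odd d)) (ℤ.-1*i≡-i (s n)))))
      (symmetric-sum n b)

  module Uᵣ = Recurrence U (λ _ → refl)
  module Vᵣ = Recurrence V (λ _ → refl)

  v² : ∀ n → V n * V n ≡ (P * P + + 4) * (U n * U n) + + 4 * σ n
  v² n = trans (cong₂ _*_ (v-via-u n) (v-via-u n))
    (trans (lemma P (U n) (U (suc n))) (cong (λ z → (P * P + + 4) * (U n * U n) + + 4 * z) (cassini n)))
    where
    lemma : ∀ P x y → (+ 2 * y - P * x) * (+ 2 * y - P * x)
                    ≡ (P * P + + 4) * (x * x) + + 4 * (y * y - P * y * x - x * x)
    lemma = solve-∀

  -- Here `V n * V n` is traded for `U n * U n` so that, once 3 divides `U n`, the second factor is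
  -- visibly 3 times a unit. `v-triple` has this shape when 3 divides `V n`.
  u-triple : ∀ n → U (n ℕ.+ n ℕ.+ n) ≡ U n * ((P * P + + 4) * (U n * U n) + + 3 * σ n)
  u-triple n = begin
    U (n ℕ.+ n ℕ.+ n)
      ≡⟨ lemma₁ (U (n ℕ.+ n ℕ.+ n)) (σ n * U n) ⟩
    U (n ℕ.+ n ℕ.+ n) + σ n * U n - σ n * U n
      ≡⟨ cong (_- σ n * U n) (Uᵣ.symmetric-sum n n) ⟩
    U (n ℕ.+ n) * V n - σ n * U n
      -- The duplication formula is `symmetric-sum` at index 0, where the sign multiplies `U 0`,
      -- which is 0.
      ≡⟨ cong (λ z → z * V n - σ n * U n) (trans (lemma₀ (U (n ℕ.+ n)) (σ n)) (Uᵣ.symmetric-sum 0 n)) ⟩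
    U n * V n * V n - σ n * U n
      ≡⟨ lemma₂ (U n) (V n) (σ n) ⟩
    U n * (V n * V n - σ n)
      ≡⟨ cong (λ z → U n * (z - σ n)) (v² n) ⟩
    U n * ((P * P + + 4) * (U n * U n) + + 4 * σ n - σ n)
      ≡⟨ cong (U n *_) (lemma₃ ((P * P + + 4) * (U n * U n)) (σ n)) ⟩
    U n * ((P * P + + 4) * (U n * U n) + + 3 * σ n) ∎
    where
    open ≡-Reasoning
    lemma₀ : ∀ a e → a ≡ a + e * + 0
    lemma₀ = solve-∀
    lemma₁ : ∀ a b → a ≡ a + b - b
    lemma₁ = solve-∀
    lemma₂ : ∀ a b e → a * b * b - e * a ≡ a * (b * b - e)
    lemma₂ = solve-∀
    lemma₃ : ∀ a e → a + + 4 * e - e ≡ a + + 3 * e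
    lemma₃ = solve-∀

  v-triple : ∀ n → V (n ℕ.+ n ℕ.+ n) ≡ V n * (V n * V n - + 3 * σ n)
  v-triple n = begin
    V (n ℕ.+ n ℕ.+ n)
      ≡⟨ lemma₁ (V (n ℕ.+ n ℕ.+ n)) (σ n * V n) ⟩
    V (n ℕ.+ n ℕ.+ n) + σ n * V n - σ n * V n
      ≡⟨ cong (_- σ n * V n) (Vᵣ.symmetric-sum n n) ⟩
    V (n ℕ.+ n) * V n - σ n * V n
      ≡⟨ cong (λ z → z * V n - σ n * V n) (trans (lemma₁ (V (n ℕ.+ n)) (σ n * + 2))
           (cong (_- σ n * + 2) (Vᵣ.symmetric-sum 0 n))) ⟩
    (V n * V n - σ n * + 2) * V n - σ n * V n
      ≡⟨ lemma₂ (V n) (σ n) ⟩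
    V n * (V n * V n - + 3 * σ n) ∎
    where
    open ≡-Reasoning
    lemma₁ : ∀ a b → a ≡ a + b - b
    lemma₁ = solve-∀
    lemma₂ : ∀ b e → (b * b - e * + 2) * b - e * b ≡ b * (b * b - + 3 * e)
    lemma₂ = solve-∀

  -- Valuations of terms and of differences of terms when 3 divides P

  module DivisibleBy3 (3∣P : + 3 ∣ P) where
    open _∣_ 3∣P renaming (quotient to p; equality to P≡p*3)

    -- `P` stays outside the bracket at even indices, so that for `c` prime to 3 the cofactor is a
    -- unit and the valuation is that of `P`.
    u-mod-3 : ∀ c → (∃[ t ] U (c ℕ.* 2) ≡ P * (+ c + + 3 * t))
                  × (∃[ t ] U (suc (c ℕ.* 2)) ≡ + 1 + + 3 * t)
    u-mod-3 zero = (+ 0 , lemma P) , (+ 0 , refl)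
      where
      lemma : ∀ P → + 0 ≡ P * (+ 0 + + 3 * + 0)
      lemma = solve-∀
    u-mod-3 (suc c) with u-mod-3 c
    ... | (t , eq) , (t′ , eq′) = (t + t′ , trans (cong₂ (λ x y → P * x + y) eq′ eq) (lemma P (+ c) t t′)) ,
        (p * U (suc (suc (c ℕ.* 2))) + t′ ,
          trans (cong₂ (λ x y → x * U (suc (suc (c ℕ.* 2))) + y) P≡p*3 eq′) (lemma′ p _ t′))
      where
      lemma : ∀ P c t t′ → P * (+ 1 + + 3 * t′) + P * (c + + 3 * t) ≡ P * (+ 1 + c + + 3 * (t + t′))
      lemma = solve-∀
      lemma′ : ∀ p x t → p * + 3 * x + (+ 1 + + 3 * t) ≡ + 1 + + 3 * (p * x + t)
      lemma′ = solve-∀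

    -- At odd indices the cofactor of `P` follows the index itself: each step adds `P` times an
    -- even-indexed term, which is 2 modulo 3.
    v-mod-3 : ∀ c → (∃[ t ] V (c ℕ.* 2) ≡ + 2 + + 3 * t)
                  × (∃[ t ] V (suc (c ℕ.* 2)) ≡ P * (+ suc (c ℕ.* 2) + + 3 * t))
    v-mod-3 zero = (+ 0 , refl) , (+ 0 , sym (ℤ.*-identityʳ P))
    v-mod-3 (suc c) with v-mod-3 c
    ... | (t , eq) , (t′ , eq′) = (t₂ , eq₂) , (t₂ + t′ ,
          trans (cong₂ (λ x y → P * x + y) eq₂ eq′) (lemma P (+ suc (c ℕ.* 2)) t₂ t′))
      where
      t₂ = p * V (suc (c ℕ.* 2)) + t
      lemma′ : ∀ p x t → p * + 3 * x + (+ 2 + + 3 * t) ≡ + 2 + + 3 * (p * x + t)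
      lemma′ = solve-∀
      eq₂ : V (suc c ℕ.* 2) ≡ + 2 + + 3 * t₂
      eq₂ = trans (cong₂ (λ x y → x * V (suc (c ℕ.* 2)) + y) P≡p*3 eq) (lemma′ p _ t)
      lemma : ∀ P c t t′ → P * (+ 2 + + 3 * t) + P * (c + + 3 * t′) ≡ P * (+ 2 + c + + 3 * (t + t′))
      lemma = solve-∀

    P∣u-even : ∀ c → P ∣ U (c ℕ.* 2)
    P∣u-even c with proj₁ (u-mod-3 c)
    ... | t , eq = subst (P ∣_) (sym eq) (∣m⇒∣m*n _ ∣-refl)

    3∣u-even : ∀ c → + 3 ∣ U (c ℕ.* 2)
    3∣u-even c = ∣-trans 3∣P (P∣u-even c)

    P∣v-odd : ∀ c → P ∣ V (suc (c ℕ.* 2))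
    P∣v-odd c with proj₂ (v-mod-3 c)
    ... | t , eq = subst (P ∣_) (sym eq) (∣m⇒∣m*n _ ∣-refl)

    u-odd-unit : ∀ n c → n ≡ suc (c ℕ.* 2) → Unit (U n)
    u-odd-unit n c refl with proj₂ (u-mod-3 c)
    ... | t , eq = subst Unit (sym eq) (unit-+3* t unit-1)

    v-even-unit : ∀ n c → n ≡ c ℕ.* 2 → Unit (V n)
    v-even-unit n c refl with proj₁ (v-mod-3 c)
    ... | t , eq = subst Unit (sym eq) (unit-+3* t unit-2)

    -- Away from 3 ∣ c the valuation is read off modulo 3; a factor 3 of the index
    -- contributes exactly one factor 3 by the tripling formula.
    u-even~ : ∀ c → U (c ℕ.* 2) ~ P * + c
    u-even~ = <-rec _ go
      where
      multiple : ∀ m → m ℕ.* 3 ℕ.* 2 ≡ m ℕ.* 2 ℕ.+ m ℕ.* 2 ℕ.+ m ℕ.* 2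
      multiple = ℕ-Solver.solve-∀
      go : ∀ c → (∀ {d} → d ℕ.< c → U (d ℕ.* 2) ~ P * + d) → U (c ℕ.* 2) ~ P * + c
      go c ih with + 3 ∣? + c
      ... | no uc with proj₁ (u-mod-3 c)
      ...   | t , eq = mk~ (+ c) (+ c + + 3 * t) uc (unit-+3* t uc)
                (trans (cong (+ c *_) eq) (lemma P (+ c) (+ c + + 3 * t)))
        where
        lemma : ∀ P c t → c * (P * t) ≡ t * (P * c)
        lemma = solve-∀
      go c ih | yes 3∣c with ∣⇒∣ᵤ 3∣c
      ... | ℕ.divides zero    refl = ~-reflexive (sym (ℤ.*-zeroʳ P))
      ... | ℕ.divides (suc m) refl = ~-trans (~-reflexive value)
              (~-trans (unit-*-~ (+ 3 * U (d ℕ.* 2)) (unit-+3* (D * y * y) unit-1))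
                (~-trans (~-* (~-refl {+ 3}) (ih (ℕ.m<m*n (suc m) 3 (s≤s (s≤s z≤n))))) (~-reflexive index)))
        where
        d = suc m
        y = _∣_.quotient (3∣u-even d)
        D = P * P + + 4
        factor : ∀ D y → (y * + 3) * (D * ((y * + 3) * (y * + 3)) + + 3 * + 1)
               ≡ (+ 1 + + 3 * (D * y * y)) * (+ 3 * (y * + 3))
        factor = solve-∀
        value : U (d ℕ.* 3 ℕ.* 2) ≡ (+ 1 + + 3 * (D * y * y)) * (+ 3 * U (d ℕ.* 2))
        value = begin
          U (d ℕ.* 3 ℕ.* 2)
            ≡⟨ cong U (multiple d) ⟩
          U (d ℕ.* 2 ℕ.+ d ℕ.* 2 ℕ.+ d ℕ.* 2)
            ≡⟨ u-triple (d ℕ.* 2) ⟩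
          U (d ℕ.* 2) * (D * (U (d ℕ.* 2) * U (d ℕ.* 2)) + + 3 * σ (d ℕ.* 2))
            ≡⟨ cong₂ (λ w e → w * (D * (w * w) + + 3 * e)) (_∣_.equality (3∣u-even d)) (σ-even d) ⟩
          (y * + 3) * (D * ((y * + 3) * (y * + 3)) + + 3 * + 1)
            ≡⟨ factor D y ⟩
          (+ 1 + + 3 * (D * y * y)) * (+ 3 * (y * + 3))
            ≡⟨ cong (λ w → (+ 1 + + 3 * (D * y * y)) * (+ 3 * w)) (sym (_∣_.equality (3∣u-even d))) ⟩
          (+ 1 + + 3 * (D * y * y)) * (+ 3 * U (d ℕ.* 2)) ∎
          where open ≡-Reasoning
        lemma : ∀ P d → + 3 * (P * d) ≡ P * (d * + 3)
        lemma = solve-∀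
        index : + 3 * (P * + d) ≡ P * + (d ℕ.* 3)
        index = trans (lemma P (+ d)) (cong (P *_) (sym (ℤ.pos-* d 3)))

    -- The argument of `u-even~` on odd indices. If 3 divides `2c + 1`, the quotient is odd, say
    -- `2d + 1`; then `c = 3d + 1`, and the tripling formula reduces the claim to `d`.
    v-odd~ : ∀ c → V (suc (c ℕ.* 2)) ~ P * + suc (c ℕ.* 2)
    v-odd~ = <-rec _ go
      where
      Goal : ℕ → Set
      Goal c = V (suc (c ℕ.* 2)) ~ P * + suc (c ℕ.* 2)
      triple : ∀ d → (∀ {c} → c ℕ.< suc (d ℕ.* 3) → Goal c) → Goal (suc (d ℕ.* 3))
      triple d ih = ~-trans (~-reflexive value)
          (~-trans (unit-*-~ (+ 3 * V n) (unit-+3* (y * y) unit-1))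
            (~-trans (~-* (~-refl {+ 3}) (ih (s≤s (ℕ.m≤m*n d 3)))) (~-reflexive index)))
        where
        n = suc (d ℕ.* 2)
        3∣v : + 3 ∣ V n
        3∣v = ∣-trans 3∣P (P∣v-odd d)
        y = _∣_.quotient 3∣v
        multiple : ∀ d → suc (suc (d ℕ.* 3) ℕ.* 2) ≡ suc (d ℕ.* 2) ℕ.+ suc (d ℕ.* 2) ℕ.+ suc (d ℕ.* 2)
        multiple = ℕ-Solver.solve-∀
        multiple′ : ∀ d → suc (d ℕ.* 2) ℕ.* 3 ≡ suc (suc (d ℕ.* 3) ℕ.* 2)
        multiple′ = ℕ-Solver.solve-∀
        factor : ∀ y → (y * + 3) * ((y * + 3) * (y * + 3) - + 3 * (- + 1))
               ≡ (+ 1 + + 3 * (y * y)) * (+ 3 * (y * + 3))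
        factor = solve-∀
        value : V (suc (suc (d ℕ.* 3) ℕ.* 2)) ≡ (+ 1 + + 3 * (y * y)) * (+ 3 * V n)
        value = begin
          V (suc (suc (d ℕ.* 3) ℕ.* 2))
            ≡⟨ cong V (multiple d) ⟩
          V (n ℕ.+ n ℕ.+ n)
            ≡⟨ v-triple n ⟩
          V n * (V n * V n - + 3 * σ n)
            ≡⟨ cong₂ (λ w e → w * (w * w - + 3 * e)) (_∣_.equality 3∣v) (σ-odd d) ⟩
          (y * + 3) * ((y * + 3) * (y * + 3) - + 3 * (- + 1))
            ≡⟨ factor y ⟩
          (+ 1 + + 3 * (y * y)) * (+ 3 * (y * + 3))
            ≡⟨ cong (λ w → (+ 1 + + 3 * (y * y)) * (+ 3 * w)) (sym (_∣_.equality 3∣v)) ⟩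
          (+ 1 + + 3 * (y * y)) * (+ 3 * V n) ∎
          where open ≡-Reasoning
        lemma : ∀ P d → + 3 * (P * d) ≡ P * (d * + 3)
        lemma = solve-∀
        index : + 3 * (P * + n) ≡ P * + suc (suc (d ℕ.* 3) ℕ.* 2)
        index = trans (lemma P (+ n)) (cong (P *_) (trans (sym (ℤ.pos-* n 3)) (cong +_ (multiple′ d))))
      go : ∀ c → (∀ {d} → d ℕ.< c → Goal d) → Goal c
      go c ih with + 3 ∣? + suc (c ℕ.* 2)
      ... | no un with proj₂ (v-mod-3 c)
      ...   | t , eq = mk~ (+ n) (+ n + + 3 * t) un (unit-+3* t un)
                (trans (cong (+ n *_) eq) (lemma P (+ n) (+ n + + 3 * t)))
        where
        n = suc (c ℕ.* 2)
        lemma : ∀ P c t → c * (P * t) ≡ t * (P * c)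
        lemma = solve-∀
      go c ih | yes 3∣n with ∣⇒∣ᵤ 3∣n
      ... | ℕ.divides m eq with parity m
      ...   | d , inj₁ refl = contradiction
                (trans (lemma d) (trans (sym eq) (cong suc (ℕ.*-comm c 2)))) (ℕ.even≢odd (d ℕ.* 3) c)
        where
        lemma : ∀ d → 2 ℕ.* (d ℕ.* 3) ≡ d ℕ.* 2 ℕ.* 3
        lemma = ℕ-Solver.solve-∀
      ...   | d , inj₂ refl with ℕ.*-cancelʳ-≡ c (suc (d ℕ.* 3)) 2 (ℕ.suc-injective (trans eq (lemma d)))
        where
        lemma : ∀ d → suc (d ℕ.* 2) ℕ.* 3 ≡ suc (suc (d ℕ.* 3) ℕ.* 2)
        lemma = ℕ-Solver.solve-∀
      ...     | refl = triple d ih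

    private
      -- Since 2 is a unit, half the index may be replaced by the index. Even u-terms and odd
      -- v-terms then have valuations of one form, so the results below do not mention the parity of
      -- `b`.
      u-even-index~ : ∀ n c → n ≡ c ℕ.* 2 → U n ~ P * + n
      u-even-index~ n c refl = ~-trans (u-even~ c) (~-* (~-refl {P})
        (~-trans (~-sym (unit-*-~ (+ c) unit-2))
          (~-reflexive (trans (ℤ.*-comm (+ 2) (+ c)) (sym (ℤ.pos-* c 2))))))

      v-odd-index~ : ∀ n c → n ≡ suc (c ℕ.* 2) → V n ~ P * + n
      v-odd-index~ n c refl = v-odd~ c

      D-unit : Unit (P * P + + 4)
      D-unit = subst Unit (sym (trans (cong (λ z → z * z + + 4) P≡p*3) (lemma p)))
        (unit-+3* (+ 1 + p * p * + 3) unit-1)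
        where
        lemma : ∀ p → p * + 3 * (p * + 3) + + 4 ≡ + 1 + + 3 * (+ 1 + p * p * + 3)
        lemma = solve-∀

      even+even : ∀ x d → x ℕ.* 2 ℕ.+ d ℕ.* 2 ≡ (x ℕ.+ d) ℕ.* 2
      even+even = ℕ-Solver.solve-∀
      even+odd : ∀ x d → x ℕ.* 2 ℕ.+ suc (d ℕ.* 2) ≡ suc ((x ℕ.+ d) ℕ.* 2)
      even+odd = ℕ-Solver.solve-∀
      odd+odd : ∀ x d → suc (x ℕ.* 2) ℕ.+ suc (d ℕ.* 2) ≡ suc (x ℕ.+ d) ℕ.* 2
      odd+odd = ℕ-Solver.solve-∀

      u-step-even : ∀ n b d → b ≡ d ℕ.* 2 → U (n ℕ.+ b ℕ.+ b) - U n ≡ V (n ℕ.+ b) * U b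
      u-step-even n b d eq = trans (Uᵣ.even-step n b d eq) (cong (_* U b) (sym (v-via-u (n ℕ.+ b))))

      v-step-even : ∀ n b d → b ≡ d ℕ.* 2 →
        V (n ℕ.+ b ℕ.+ b) - V n ≡ (P * P + + 4) * U (n ℕ.+ b) * U b
      v-step-even n b d eq = trans (Vᵣ.even-step n b d eq) (cong (_* U b) (u-via-v (n ℕ.+ b)))

    -- For either parity of `b`, the factor at the middle index is a unit and only the factor at `b`
    -- contributes.
    u-even-step~ : ∀ x b → U (x ℕ.* 2 ℕ.+ b ℕ.+ b) - U (x ℕ.* 2) ~ P * + b
    u-even-step~ x b with parity b
    ... | d , inj₁ refl = ~-trans (~-reflexive (u-step-even (x ℕ.* 2) b d refl))
            (~-trans (unit-*-~ (U b) (v-even-unit _ (x ℕ.+ d) (even+even x d))) (u-even-index~ b d refl))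
    ... | d , inj₂ refl = ~-trans (~-reflexive (Uᵣ.odd-step (x ℕ.* 2) b d refl))
            (~-trans (unit-*-~ (V b) (u-odd-unit _ (x ℕ.+ d) (even+odd x d))) (v-odd-index~ b d refl))

    -- Now both factors are divisible by `P`. The product of the indices n + b and b is a quarter of
    -- (n + 2b)² - n², the source of the squares.
    u-odd-step~ : ∀ x b → let n = suc (x ℕ.* 2) in
      U (n ℕ.+ b ℕ.+ b) - U n ~ P * + (n ℕ.+ b) * (P * + b)
    u-odd-step~ x b with parity b
    ... | d , inj₁ refl = ~-trans (~-reflexive (u-step-even (suc (x ℕ.* 2)) b d refl))
            (~-* (v-odd-index~ _ (x ℕ.+ d) (cong suc (even+even x d))) (u-even-index~ b d refl))
    ... | d , inj₂ refl = ~-trans (~-reflexive (Uᵣ.odd-step (suc (x ℕ.* 2)) b d refl))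
            (~-* (u-even-index~ _ (suc (x ℕ.+ d)) (odd+odd x d)) (v-odd-index~ b d refl))

    v-odd-step~ : ∀ x b → let n = suc (x ℕ.* 2) in V (n ℕ.+ b ℕ.+ b) - V n ~ P * + b
    v-odd-step~ x b with parity b
    ... | d , inj₁ refl = ~-trans (~-reflexive (v-step-even (suc (x ℕ.* 2)) b d refl))
            (~-trans (unit-*-~ (U b) (unit-* D-unit (u-odd-unit _ (x ℕ.+ d) (cong suc (even+even x d)))))
              (u-even-index~ b d refl))
    ... | d , inj₂ refl = ~-trans (~-reflexive (Vᵣ.odd-step (suc (x ℕ.* 2)) b d refl))
            (~-trans (unit-*-~ (V b) (v-even-unit _ (suc (x ℕ.+ d)) (odd+odd x d))) (v-odd-index~ b d refl))

    v-even-step~ : ∀ x b → let n = x ℕ.* 2 in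
      V (n ℕ.+ b ℕ.+ b) - V n ~ P * + (n ℕ.+ b) * (P * + b)
    v-even-step~ x b with parity b
    ... | d , inj₁ refl = ~-trans (~-reflexive (v-step-even (x ℕ.* 2) b d refl))
            (~-* (~-trans (unit-*-~ (U (x ℕ.* 2 ℕ.+ b)) D-unit) (u-even-index~ _ (x ℕ.+ d) (even+even x d)))
              (u-even-index~ b d refl))
    ... | d , inj₂ refl = ~-trans (~-reflexive (Vᵣ.odd-step (x ℕ.* 2) b d refl))
            (~-* (v-odd-index~ _ (x ℕ.+ d) (even+odd x d)) (v-odd-index~ b d refl))

-- Residue counts for a linear and a quadratic half

module Distribution where
  open import Data.Integer.Base using (-_; _+_; _*_; _-_)
  open ThreeAdic
  open Counting

  ∣-chain : ∀ {M} a b c → M ∣ a - b → M ∣ b - c → M ∣ a - c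
  ∣-chain {M} a b c d e = subst (M ∣_) (lemma a b c) (∣m∣n⇒∣m+n d e)
    where
    lemma : ∀ a b c → (a - b) + (b - c) ≡ a - c
    lemma = solve-∀

  3^-*-∣ : ∀ i j {a b} → 3^ i ∣ a → 3^ j ∣ b → 3^ (i ℕ.+ j) ∣ a * b
  3^-*-∣ i j {a} {b} (divides q refl) d = subst₂ _∣_ (sym (3^-+ i j)) (lemma q (3^ i) b)
    (∣n⇒∣m*n q (*-monoʳ-∣ (3^ i) d))
    where
    lemma : ∀ q t b → q * (t * b) ≡ q * t * b
    lemma = solve-∀

  3^2-* : ∀ i a → 3^ (i ℕ.+ i) * (a * a) ≡ (3^ i * a) * (3^ i * a)
  3^2-* i a = trans (cong (_* (a * a)) (3^-+ i i)) (lemma (3^ i) a)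
    where
    lemma : ∀ t a → t * t * (a * a) ≡ (t * a) * (t * a)
    lemma = solve-∀

  unit⇒3∣square-1 : ∀ a → Unit a → + 3 ∣ a * a - + 1
  unit⇒3∣square-1 a ua = conclude (residue-exists 3 a)
    where
    factor₀ : ∀ a → - (+ 0 - a) ≡ a
    factor₀ = solve-∀
    factor₁ : ∀ a → (- (a + + 1)) * (+ 1 - a) ≡ a * a - + 1
    factor₁ = solve-∀
    factor₂ : ∀ a → (- (a + + 2)) * (+ 2 - a) + + 3 ≡ a * a - + 1
    factor₂ = solve-∀
    conclude : ∃[ x ] (x < 3 × + 3 ∣ + x - a) → + 3 ∣ a * a - + 1
    conclude (0 , _ , d) = contradiction (subst (+ 3 ∣_) (factor₀ a) (∣m⇒∣-m d)) ua
    conclude (1 , _ , d) = subst (+ 3 ∣_) (factor₁ a) (∣n⇒∣m*n (- (a + + 1)) d)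
    conclude (2 , _ , d) = subst (+ 3 ∣_) (factor₂ a) (∣m∣n⇒∣m+n (∣n⇒∣m*n (- (a + + 2)) d) ∣-refl)
    conclude (suc (suc (suc _)) , s≤s (s≤s (s≤s ())) , _)

  units⇒3∣square-difference : ∀ {a b} → Unit a → Unit b → + 3 ∣ a * a - b * b
  units⇒3∣square-difference {a} {b} ua ub = ∣-chain (a * a) (+ 1) (b * b) (unit⇒3∣square-1 a ua)
    (∣-swap (b * b) (+ 1) (unit⇒3∣square-1 b ub))

  half-≥ : ∀ k → k ≤ suc (k ℕ./ 2 ℕ.+ k ℕ./ 2)
  half-≥ k = begin
    k                            ≡⟨ ℕ.m≡m%n+[m/n]*n k 2 ⟩
    k ℕ.% 2 ℕ.+ k ℕ./ 2 ℕ.* 2    ≤⟨ ℕ.+-monoˡ-≤ _ (ℕ.≤-pred (ℕ.m%n<n k 2)) ⟩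
    suc (k ℕ./ 2 ℕ.* 2)          ≡⟨ cong suc (lemma (k ℕ./ 2)) ⟩
    suc (k ℕ./ 2 ℕ.+ k ℕ./ 2)    ∎
    where
    open ℕ.≤-Reasoning
    lemma : ∀ h → h ℕ.* 2 ≡ h ℕ.+ h
    lemma = ℕ-Solver.solve-∀

  half-≤ : ∀ k → k ℕ./ 2 ℕ.+ k ℕ./ 2 ≤ k
  half-≤ k = subst (_≤ k) (lemma (k ℕ./ 2)) (ℕ.m/n*n≤m k 2)
    where
    lemma : ∀ h → h ℕ.* 2 ≡ h ℕ.+ h
    lemma = ℕ-Solver.solve-∀

  -- A is the half of a Lucas sequence divisible by 3 and B the half prime to 3; N x is the
  -- index of the term B x, and base e the position in B of the index 3^e or 2·3^e.
  record SquareLike (δ c : ℕ) (A B : ℕ → ℤ) : Set where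
    N : ℕ → ℤ
    N x = + (c ℕ.+ x ℕ.* 2)
    field
      A-difference : ∀ x y → A x - A y ~ 3^ δ * (+ x - + y)
      A-divisible  : ∀ x → 3^ δ ∣ A x
      B-difference : ∀ x y → B x - B y ~ 3^ (δ ℕ.+ δ) * (N x * N x - N y * N y)
      B-unit       : ∀ x → Unit (B x)
      base         : ℕ → ℕ
      τ            : ℤ
      τ-unit       : Unit τ
      N-base       : ∀ e → N (base e) ≡ τ * 3^ e

  module Counts {δ c : ℕ} {A B : ℕ → ℤ} (S : SquareLike δ c A B) (1≤δ : 1 ≤ δ)
                (k : ℕ) (δ≤k : δ ≤ k) where
    open SquareLike S

    -- Each half contributes `3 ^ K` terms to a period.
    K : ℕ
    K = k ℕ.∸ δ

    δ+K≡k : δ ℕ.+ K ≡ k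
    δ+K≡k = ℕ.m+[n∸m]≡n δ≤k

    3∣3^ : ∀ {i} → 1 ≤ i → + 3 ∣ 3^ i
    3∣3^ 1≤i = 3^-mono-∣ {1} 1≤i

    A-∣⇒ : ∀ x y → 3^ k ∣ A x - A y → 3^ K ∣ + x - + y
    A-∣⇒ x y d = 3^-*-cancel-∣ δ K (subst (λ i → 3^ i ∣ 3^ δ * (+ x - + y)) (sym δ+K≡k)
      (~-∣ k (A-difference x y) d))

    A-∣⇐ : ∀ x y → 3^ K ∣ + x - + y → 3^ k ∣ A x - A y
    A-∣⇐ x y d = ~-∣ k (~-sym (A-difference x y)) (subst (λ i → 3^ i ∣ 3^ δ * (+ x - + y)) δ+K≡k
      (3^-*-mono-∣ δ K d))

    B-∣⇒ : ∀ i x y → 3^ i ∣ B x - B y → 3^ i ∣ 3^ (δ ℕ.+ δ) * (N x * N x - N y * N y)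
    B-∣⇒ i x y = ~-∣ i (B-difference x y)

    B-∣⇐ : ∀ i x y → 3^ i ∣ 3^ (δ ℕ.+ δ) * (N x * N x - N y * N y) → 3^ i ∣ B x - B y
    B-∣⇐ i x y = ~-∣ i (~-sym (B-difference x y))

    N-minus : ∀ x y → N x - N y ≡ + 2 * (+ x - + y)
    N-minus x y = trans (cong₂ (λ a b → + c + a - (+ c + b)) (ℤ.pos-* x 2) (ℤ.pos-* y 2))
      (lemma (+ c) (+ x) (+ y))
      where
      lemma : ∀ c x y → (c + x * + 2) - (c + y * + 2) ≡ + 2 * (x - y)
      lemma = solve-∀

    -- Since 2 is a unit, the opposite root `N x ≡ - N y` is again a single residue class of
    -- positions, that of `- (y + c)`.
    N-plus : ∀ x y → N x + N y ≡ + 2 * (+ x - (- (+ y + + c)))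
    N-plus x y = trans (cong₂ (λ a b → + c + a + (+ c + b)) (ℤ.pos-* x 2) (ℤ.pos-* y 2))
      (lemma (+ c) (+ x) (+ y))
      where
      lemma : ∀ c x y → (c + x * + 2) + (c + y * + 2) ≡ + 2 * (x - (- (y + c)))
      lemma = solve-∀

    ≡B⇒unit : ∀ {i b} x → 1 ≤ i → 3^ i ∣ b - B x → Unit b
    ≡B⇒unit {i} {b} x 1≤i d 3∣b = B-unit x (subst (+ 3 ∣_) (lemma b (B x))
      (∣m∣n⇒∣m-n 3∣b (∣-trans (3∣3^ 1≤i) d)))
      where
      lemma : ∀ b x → b - (b - x) ≡ x
      lemma = solve-∀

    1≤k : 1 ≤ k
    1≤k = ℕ.≤-trans 1≤δ δ≤k

    A-period : ∀ x → 3^ k ∣ A (x ℕ.+ 3 ℕ.^ K) - A x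
    A-period x = A-∣⇐ (x ℕ.+ 3 ℕ.^ K) x (subst (3^ K ∣_) (sym (lemma (+ x) (3^ K))) ∣-refl)
      where
      lemma : ∀ x y → (x + y) - x ≡ y
      lemma = solve-∀

    -- The linear half dictates the period; here the factor 3^(2δ) leaves δ powers of 3 to spare.
    B-period : ∀ x → 3^ k ∣ B (x ℕ.+ 3 ℕ.^ K) - B x
    B-period x = B-∣⇐ k y x (∣-trans (3^-mono-∣ k≤) (3^-*-mono-∣ (δ ℕ.+ δ) K
        (subst (3^ K ∣_) (lemma₂ (N y) (N x)) (∣m⇒∣m*n (N y + N x)
          (subst (3^ K ∣_) (sym (trans (N-minus y x) (cong (+ 2 *_) (lemma₁ (+ x) (3^ K)))))
            (∣n⇒∣m*n (+ 2) ∣-refl))))))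
      where
      y : ℕ
      y = x ℕ.+ 3 ℕ.^ K
      k≤ : k ≤ δ ℕ.+ δ ℕ.+ K
      k≤ = subst (_≤ δ ℕ.+ δ ℕ.+ K) δ+K≡k (ℕ.+-monoˡ-≤ K (ℕ.m≤m+n δ δ))
      lemma₁ : ∀ x y → (x + y) - x ≡ y
      lemma₁ = solve-∀
      lemma₂ : ∀ a b → (a - b) * (a + b) ≡ a * a - b * b
      lemma₂ = solve-∀

    countA countB total : ℤ → ℕ
    countA b = count (λ x → A x ≡? b [mod 3 ℕ.^ k ]) (3 ℕ.^ K)
    countB b = count (λ x → B x ≡? b [mod 3 ℕ.^ k ]) (3 ℕ.^ K)
    total b = countA b ℕ.+ countB b

    -- Modulo 3^k there are as many multiples of 3^δ as positions, namely 3^K, and `A` is injective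
    -- on positions modulo 3^K.
    countA-hit : ∀ b → 3^ δ ∣ b → countA b ≡ 1
    countA-hit b 3^δ∣b = conclude (injective⇒surjective δ K A b
        (λ x → ∣m∣n⇒∣m-n (A-divisible x) 3^δ∣b)
        (λ x y d → A-∣⇒ x y (subst (λ i → 3^ i ∣ A x - A y) δ+K≡k d)))
      where
      conclude : ∃[ x ] (x < 3 ℕ.^ K × 3^ (δ ℕ.+ K) ∣ A x - b) → countA b ≡ 1
      conclude (x , x<n , d) = count-unique (λ x → A x ≡? b [mod 3 ℕ.^ k ]) (3 ℕ.^ K) x x<n hit
          (λ y y<n e → ∣-difference⇒≡ y<n x<n (A-∣⇒ y x (∣-chain (A y) b (A x) e (∣-swap (A x) b hit))))
        where
        hit : 3^ k ∣ A x - b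
        hit = subst (λ i → 3^ i ∣ A x - b) δ+K≡k d

    countA-miss : ∀ b → ¬ (3^ δ ∣ b) → countA b ≡ 0
    countA-miss b ∤b = count-none _ (3 ℕ.^ K) λ x _ d → ∤b (subst (3^ δ ∣_) (lemma (A x) b)
      (∣m∣n⇒∣m-n (A-divisible x) (∣-trans (3^-mono-∣ δ≤k) d)))
      where
      lemma : ∀ a b → a - (a - b) ≡ b
      lemma = solve-∀

    unit⇒3^δ∤ : ∀ {b} → Unit b → ¬ (3^ δ ∣ b)
    unit⇒3^δ∤ ub d = ub (∣-trans (3∣3^ 1≤δ) d)

    total-divisible : ∀ b → 3^ δ ∣ b → total b ≡ 1
    total-divisible b d = cong₂ ℕ._+_ (countA-hit b d) (count-none _ (3 ℕ.^ K)
      λ x _ e → ≡B⇒unit x 1≤k (∣-swap (B x) b e) (∣-trans (3∣3^ 1≤δ) d))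

    -- Serves every residue whose preimage under `B` is one class of positions modulo 3^f; `f = 0`
    -- is the case of a constant `B`.
    total-class : ∀ b x₀ f g → f ℕ.+ g ≡ K → 3^ k ∣ b - B x₀ →
      (∀ x → 3^ k ∣ B x - B x₀ → 3^ f ∣ N x - N x₀) →
      (∀ x → 3^ f ∣ N x - N x₀ → 3^ k ∣ B x - B x₀) → total b ≡ 3 ℕ.^ g
    total-class b x₀ f g f+g≡K b≡ to from =
      cong₂ ℕ._+_ (countA-miss b (unit⇒3^δ∤ (≡B⇒unit x₀ 1≤k b≡))) (begin
        countB b
          ≡⟨ count-cong _ (λ x → 3^ f ∣? (+ x - + x₀))
               (λ x d → unit-cancel-∣ f unit-2 (subst (3^ f ∣_) (N-minus x x₀)
                 (to x (∣-chain (B x) b (B x₀) d b≡))))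
               (λ x d → ∣-chain (B x) (B x₀) b (from x (subst (3^ f ∣_) (sym (N-minus x x₀))
                 (∣n⇒∣m*n (+ 2) d))) (∣-swap b (B x₀) b≡)) (3 ℕ.^ K) ⟩
        count (λ x → 3^ f ∣? (+ x - + x₀)) (3 ℕ.^ K)
          ≡⟨ cong (count (λ x → 3^ f ∣? (+ x - + x₀))) size ⟩
        count (λ x → 3^ f ∣? (+ x - + x₀)) (3 ℕ.^ g ℕ.* 3 ℕ.^ f)
          ≡⟨ count-residue-class (3 ℕ.^ f) {{ℕ.m^n≢0 3 f}} (3 ℕ.^ g) (+ x₀) ⟩
        3 ℕ.^ g ∎)
      where
      open ≡-Reasoning
      size : 3 ℕ.^ K ≡ 3 ℕ.^ g ℕ.* 3 ℕ.^ f
      size = trans (cong (3 ℕ.^_) (trans (sym f+g≡K) (ℕ.+-comm f g))) (ℕ.^-distribˡ-+-* 3 g f)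

    -- The factor 3^(2δ) vanishes modulo 3^k by itself, whatever the indices.
    B-small : k ≤ δ ℕ.+ δ → ∀ x y → 3^ k ∣ B x - B y
    B-small k≤2δ x y = B-∣⇐ k x y (∣m⇒∣m*n _ (3^-mono-∣ k≤2δ))

    total-small : k ≤ δ ℕ.+ δ → ∀ b x₀ → 3^ k ∣ b - B x₀ → total b ≡ 3 ℕ.^ K
    total-small k≤2δ b x₀ b≡ = total-class b x₀ 0 K refl b≡ (λ x _ → 3^0∣ (N x - N x₀))
      (λ x _ → B-small k≤2δ x x₀)

    total-small-miss : k ≤ δ ℕ.+ δ → ∀ b x₀ → ¬ (3^ k ∣ b - B x₀) → ¬ (3^ δ ∣ b) → total b ≡ 0
    total-small-miss k≤2δ b x₀ b≢ ∤b = cong₂ ℕ._+_ (countA-miss b ∤b)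
      (count-none _ (3 ℕ.^ K) λ x _ d → b≢ (∣-chain b (B x) (B x₀) (∣-swap (B x) b d) (B-small k≤2δ x x₀)))

    -- f is chosen so that 3^(2δ) n² vanishes modulo 3^k exactly when 3^f divides n.
    module Large (2δ∸1≤k : 2 ℕ.* δ ℕ.∸ 1 ≤ k) where
      H F f : ℕ
      H = k ℕ./ 2
      -- `F` is k/2 rounded up, the valuation that 3^δ n needs for its square to vanish modulo 3^k.
      F = k ℕ.∸ H
      f = F ℕ.∸ δ

      F+H≡k : F ℕ.+ H ≡ k
      F+H≡k = ℕ.m∸n+n≡m (ℕ.≤-trans (ℕ.m≤m+n H H) (half-≤ k))

      F+F≤1+k : F ℕ.+ F ≤ suc k
      F+F≤1+k = begin
        F ℕ.+ F       ≤⟨ ℕ.+-monoʳ-≤ F F≤1+H ⟩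
        F ℕ.+ suc H   ≡⟨ ℕ.+-suc F H ⟩
        suc (F ℕ.+ H) ≡⟨ cong suc F+H≡k ⟩
        suc k         ∎
        where
        open ℕ.≤-Reasoning
        F≤1+H : F ≤ suc H
        F≤1+H = ℕ.+-cancelʳ-≤ H F (suc H) (subst (_≤ suc (H ℕ.+ H)) (sym F+H≡k) (half-≥ k))

      k≤F+F : k ≤ F ℕ.+ F
      k≤F+F = subst (_≤ F ℕ.+ F) F+H≡k (ℕ.+-monoʳ-≤ F
        (ℕ.+-cancelʳ-≤ H H F (subst (H ℕ.+ H ≤_) (sym F+H≡k) (half-≤ k))))

      -- From 2F ≥ k ≥ 2δ - 1 and parity; the bound 2δ - 1 is thus as good as 2δ.
      δ≤F : δ ≤ F
      δ≤F with δ ℕ.≤? F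
      ... | yes p = p
      ... | no ¬p = contradiction (begin-strict
        suc (F ℕ.+ F)         <⟨ ℕ.n<1+n _ ⟩
        suc (suc (F ℕ.+ F))   ≡⟨ ℕ.+-suc (suc F) F ⟨
        suc F ℕ.+ suc F       ≤⟨ ℕ.+-mono-≤ (ℕ.≰⇒> ¬p) (ℕ.≰⇒> ¬p) ⟩
        δ ℕ.+ δ               ≡⟨ cong (δ ℕ.+_) (ℕ.+-identityʳ δ) ⟨
        2 ℕ.* δ               ≤⟨ ℕ.m≤n+m∸n (2 ℕ.* δ) 1 ⟩
        suc (2 ℕ.* δ ℕ.∸ 1)   ≤⟨ s≤s 2δ∸1≤k ⟩
        suc k                 ≤⟨ s≤s k≤F+F ⟩
        suc (F ℕ.+ F)         ∎) (ℕ.<-irrefl refl)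
        where open ℕ.≤-Reasoning

      δ+f≡F : δ ℕ.+ f ≡ F
      δ+f≡F = ℕ.m+[n∸m]≡n δ≤F

      f+H≡K : f ℕ.+ H ≡ K
      f+H≡K = ℕ.+-cancelˡ-≡ δ (f ℕ.+ H) K (begin
        δ ℕ.+ (f ℕ.+ H)  ≡⟨ ℕ.+-assoc δ f H ⟨
        δ ℕ.+ f ℕ.+ H    ≡⟨ cong (ℕ._+ H) δ+f≡F ⟩
        F ℕ.+ H          ≡⟨ F+H≡k ⟩
        k                ≡⟨ δ+K≡k ⟨
        δ ℕ.+ K          ∎)
        where open ≡-Reasoning

      square-vanishes : ∀ n → 3^ f ∣ n → 3^ k ∣ 3^ (δ ℕ.+ δ) * (n * n)
      square-vanishes n d = subst (3^ k ∣_) (sym (3^2-* δ n))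
        (∣-trans (3^-mono-∣ k≤F+F) (3^-*-∣ F F {3^ δ * n} {3^ δ * n} d′ d′))
        where
        d′ : 3^ F ∣ 3^ δ * n
        d′ = subst (λ i → 3^ i ∣ 3^ δ * n) δ+f≡F (3^-*-mono-∣ δ f d)

      vanishing-square : ∀ n → 3^ k ∣ 3^ (δ ℕ.+ δ) * (n * n) → 3^ f ∣ n
      vanishing-square n d = 3^-*-cancel-∣ δ f (subst (λ i → 3^ i ∣ 3^ δ * n) (sym δ+f≡F)
        (square-∣ F k (3^ δ * n) F+F≤1+k (subst (3^ k ∣_) (3^2-* δ n) d)))

      distrib-minus : ∀ t a b → t * (a - b) ≡ t * a - t * b
      distrib-minus = solve-∀

      B-vanishing : ∀ x y → 3^ f ∣ N x → 3^ f ∣ N y → 3^ k ∣ B x - B y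
      B-vanishing x y dx dy = B-∣⇐ k x y (subst (3^ k ∣_)
        (sym (distrib-minus (3^ (δ ℕ.+ δ)) (N x * N x) (N y * N y)))
        (∣m∣n⇒∣m-n (square-vanishes (N x) dx) (square-vanishes (N y) dy)))

      -- With the square of `N x₀` equal to 0, agreeing with `B x₀` means that the square of `N x`
      -- vanishes too, that is, 3^f divides `N x`.
      total-vanishing : ∀ b x₀ → 3^ f ∣ N x₀ → 3^ k ∣ b - B x₀ → total b ≡ 3 ℕ.^ H
      total-vanishing b x₀ d₀ b≡ = total-class b x₀ f H f+H≡K b≡ to from
        where
        cancel : ∀ a b → a - b + b ≡ a
        cancel = solve-∀
        to : ∀ x → 3^ k ∣ B x - B x₀ → 3^ f ∣ N x - N x₀
        to x d = ∣m∣n⇒∣m-n (vanishing-square (N x) (subst (3^ k ∣_)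
          (trans (cong (_+ 3^ (δ ℕ.+ δ) * (N x₀ * N x₀)) (distrib-minus (3^ (δ ℕ.+ δ)) (N x * N x) (N x₀ * N x₀)))
            (cancel (3^ (δ ℕ.+ δ) * (N x * N x)) (3^ (δ ℕ.+ δ) * (N x₀ * N x₀))))
          (∣m∣n⇒∣m+n (B-∣⇒ k x x₀ d) (square-vanishes (N x₀) d₀)))) d₀
        from : ∀ x → 3^ f ∣ N x - N x₀ → 3^ k ∣ B x - B x₀
        from x d = B-vanishing x x₀ (subst (3^ f ∣_) (cancel (N x) (N x₀)) (∣m∣n⇒∣m+n d d₀)) d₀

      -- If `b` were `B x`, either 3^f divides `N x`, the vanishing class, or `N x` is 3^e m with
      -- `e < f`. In that case m² ≡ τ² modulo 3 places `b` in the class of `base e` modulo 3^(2l+1),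
      -- with l = δ + e.
      total-miss : ∀ b x₀ → 3^ f ∣ N x₀ → ¬ (3^ k ∣ b - B x₀) →
        ¬ (∃[ l ] (δ ≤ l × l ≤ (k ℕ.∸ 1) ℕ./ 2 × 3^ (2 ℕ.* l ℕ.+ 1) ∣ b - B (base (l ℕ.∸ δ)))) →
        ¬ (3^ δ ∣ b) → total b ≡ 0
      total-miss b x₀ d₀ ¬first ¬second ∤b = cong₂ ℕ._+_ (countA-miss b ∤b)
        (count-none _ (3 ℕ.^ K) λ x _ d → impossible x (∣-swap (B x) b d))
        where
        impossible : ∀ x → ¬ (3^ k ∣ b - B x)
        impossible x d with ∣-or-factor f (N x)
        ... | inj₁ e = ¬first (∣-chain b (B x) (B x₀) d (B-vanishing x x₀ e d₀))
        ... | inj₂ (e , m , e<f , eq , um) = ¬second (δ ℕ.+ e , ℕ.m≤m+n δ e , l≤ ,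
                subst (λ i → 3^ (2 ℕ.* (δ ℕ.+ e) ℕ.+ 1) ∣ b - B (base i)) (sym (ℕ.m+n∸m≡n δ e))
                  (∣-chain b (B x) (B (base e)) (∣-trans (3^-mono-∣ 2l+1≤k) d)
                    (B-∣⇐ (2 ℕ.* (δ ℕ.+ e) ℕ.+ 1) x (base e) (subst₂ _∣_ (cong 3^_ (exponent δ e)) (sym square)
                      (3^-*-mono-∣ (δ ℕ.+ δ) (e ℕ.+ e ℕ.+ 1) (3^-*-mono-∣ (e ℕ.+ e) 1
                        (units⇒3∣square-difference um τ-unit)))))))
          where
          exponent : ∀ δ e → δ ℕ.+ δ ℕ.+ (e ℕ.+ e ℕ.+ 1) ≡ 2 ℕ.* (δ ℕ.+ e) ℕ.+ 1
          exponent = ℕ-Solver.solve-∀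
          factor : ∀ t m τ → (t * m) * (t * m) - (τ * t) * (τ * t) ≡ t * t * (m * m - τ * τ)
          factor = solve-∀
          square : 3^ (δ ℕ.+ δ) * (N x * N x - N (base e) * N (base e)) ≡
                   3^ (δ ℕ.+ δ) * (3^ (e ℕ.+ e) * (m * m - τ * τ))
          square = cong (3^ (δ ℕ.+ δ) *_) (trans (cong₂ (λ a b → a * a - b * b) eq (N-base e))
            (trans (factor (3^ e) m τ) (cong (_* (m * m - τ * τ)) (sym (3^-+ e e)))))
          l : ℕ
          l = δ ℕ.+ e
          1+l≤F : suc l ≤ F
          1+l≤F = subst (suc l ≤_) δ+f≡F (ℕ.+-monoʳ-< δ e<f)
          double : ∀ l → suc l ℕ.+ suc l ≡ suc (2 ℕ.* l ℕ.+ 1)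
          double = ℕ-Solver.solve-∀
          2l+1≤k : 2 ℕ.* l ℕ.+ 1 ≤ k
          2l+1≤k = ℕ.≤-pred (subst (_≤ suc k) (double l) (ℕ.≤-trans (ℕ.+-mono-≤ 1+l≤F 1+l≤F) F+F≤1+k))
          l≤ : l ≤ (k ℕ.∸ 1) ℕ./ 2
          l≤ = subst (_≤ (k ℕ.∸ 1) ℕ./ 2) (ℕ.m*n/n≡m l 2) (ℕ./-monoˡ-≤ 2
            (subst (_≤ k ℕ.∸ 1) (ℕ.*-comm 2 l) (subst (_≤ k ℕ.∸ 1) (ℕ.m+n∸n≡m (2 ℕ.* l) 1)
              (ℕ.∸-monoˡ-≤ 1 2l+1≤k))))

  -- Solves n² ≡ n₁² modulo 3^(2e+g+1) for n₁ of valuation exactly e. The solutions are n ≡ n₁ and n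
  -- ≡ -n₁, known only modulo 3^(e+g+1) because the other factor always absorbs 3^e.
  module SquareRoots (e g : ℕ) (m₁ : ℤ) (m₁-unit : Unit m₁) where
    n₁ : ℤ
    n₁ = 3^ e * m₁

    2m₁-unit : Unit (+ 2 * m₁)
    2m₁-unit = unit-* unit-2 m₁-unit

    private
      sum-via-difference : ∀ a b → (a - b) + + 2 * b ≡ a + b
      sum-via-difference = solve-∀
      difference-via-sum : ∀ a b → (a + b) - + 2 * b ≡ a - b
      difference-via-sum = solve-∀
      difference-of-squares : ∀ a b → (a - b) * (a + b) ≡ a * a - b * b
      difference-of-squares = solve-∀

    3^e∣2n₁ : 3^ e ∣ + 2 * n₁
    3^e∣2n₁ = ∣n⇒∣m*n (+ 2) (∣m⇒∣m*n m₁ ∣-refl)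

    -- First 3^e divides `n`, say n = 3^e m. Then m - m₁ and m + m₁ differ by the unit 2m₁, so 3
    -- divides at most one of them and the other takes no part of 3^(g+1).
    roots : ∀ n → 3^ (e ℕ.+ e ℕ.+ suc g) ∣ n * n - n₁ * n₁ →
      3^ (e ℕ.+ suc g) ∣ n - n₁ ⊎ 3^ (e ℕ.+ suc g) ∣ n + n₁
    roots n d = step (square-∣ e (e ℕ.+ e) n (ℕ.n≤1+n _)
        (subst (3^ (e ℕ.+ e) ∣_) (cancel (n * n) (n₁ * n₁))
          (∣m∣n⇒∣m+n (∣-trans (3^-mono-∣ (ℕ.m≤m+n (e ℕ.+ e) (suc g))) d)
            (3^-*-∣ e e {n₁} {n₁} 3^e∣n₁ 3^e∣n₁))))
      where
      cancel : ∀ a b → a - b + b ≡ a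
      cancel = solve-∀
      3^e∣n₁ : 3^ e ∣ n₁
      3^e∣n₁ = ∣m⇒∣m*n m₁ ∣-refl
      step : 3^ e ∣ n → 3^ (e ℕ.+ suc g) ∣ n - n₁ ⊎ 3^ (e ℕ.+ suc g) ∣ n + n₁
      step (divides m refl) = split (+ 3 ∣? (m - m₁))
        where
        factor : ∀ m t m₁ → (m * t) * (m * t) - (t * m₁) * (t * m₁) ≡ t * t * ((m - m₁) * (m + m₁))
        factor = solve-∀
        minus : ∀ m t m₁ → t * (m - m₁) ≡ m * t - t * m₁
        minus = solve-∀
        plus : ∀ m t m₁ → t * (m + m₁) ≡ m * t + t * m₁
        plus = solve-∀
        product : 3^ (suc g) ∣ (m - m₁) * (m + m₁)
        product = 3^-*-cancel-∣ (e ℕ.+ e) (suc g) (subst (3^ (e ℕ.+ e ℕ.+ suc g) ∣_)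
          (trans (factor m (3^ e) m₁) (cong (_* ((m - m₁) * (m + m₁))) (sym (3^-+ e e)))) d)
        split : _ → _
        split (yes 3∣-) = inj₁ (subst (3^ (e ℕ.+ suc g) ∣_) (minus m (3^ e) m₁)
          (3^-*-mono-∣ e (suc g) (unit-cancel-∣ (suc g) m+m₁-unit
            (subst (3^ (suc g) ∣_) (ℤ.*-comm (m - m₁) (m + m₁)) product))))
          where
          m+m₁-unit : Unit (m + m₁)
          m+m₁-unit 3∣+ = 2m₁-unit (∣m+n∣m⇒∣n (subst (+ 3 ∣_) (sym (sum-via-difference m m₁)) 3∣+) 3∣-)
        split (no m-m₁-unit) = inj₂ (subst (3^ (e ℕ.+ suc g) ∣_) (plus m (3^ e) m₁)
          (3^-*-mono-∣ e (suc g) (unit-cancel-∣ (suc g) m-m₁-unit product)))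

    roots⁻¹ : ∀ n → 3^ (e ℕ.+ suc g) ∣ n - n₁ ⊎ 3^ (e ℕ.+ suc g) ∣ n + n₁ →
      3^ (e ℕ.+ e ℕ.+ suc g) ∣ n * n - n₁ * n₁
    roots⁻¹ n (inj₁ d) = subst₂ _∣_ (cong 3^_ (exponent e (suc g))) (difference-of-squares n n₁)
      (3^-*-∣ (e ℕ.+ suc g) e d (subst (3^ e ∣_) (sum-via-difference n n₁)
        (∣m∣n⇒∣m+n (∣-trans (3^-mono-∣ (ℕ.m≤m+n e (suc g))) d) 3^e∣2n₁)))
      where
      exponent : ∀ e g → e ℕ.+ g ℕ.+ e ≡ e ℕ.+ e ℕ.+ g
      exponent = ℕ-Solver.solve-∀
    roots⁻¹ n (inj₂ d) = subst₂ _∣_ (cong 3^_ (exponent e (suc g))) (difference-of-squares n n₁)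
      (3^-*-∣ e (e ℕ.+ suc g) (subst (3^ e ∣_) (difference-via-sum n n₁)
        (∣m∣n⇒∣m-n (∣-trans (3^-mono-∣ (ℕ.m≤m+n e (suc g))) d) 3^e∣2n₁)) d)
      where
      exponent : ∀ e g → e ℕ.+ (e ℕ.+ g) ≡ e ℕ.+ e ℕ.+ g
      exponent = ℕ-Solver.solve-∀

    -- The sum and the difference differ by 2n₁, of valuation e; the successor in `suc g` puts the
    -- modulus beyond that.
    roots-distinct : ∀ n → 3^ (e ℕ.+ suc g) ∣ n - n₁ → ¬ (3^ (e ℕ.+ suc g) ∣ n + n₁)
    roots-distinct n d d′ = 2m₁-unit (3^-*-cancel-∣ e 1 (∣-trans
      (3^-mono-∣ (ℕ.+-monoʳ-≤ e (s≤s z≤n))) (subst (3^ (e ℕ.+ suc g) ∣_) (lemma n (3^ e) m₁) (∣m∣n⇒∣m-n d′ d))))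
      where
      lemma : ∀ n t m → (n + t * m) - (n - t * m) ≡ t * (+ 2 * m)
      lemma = solve-∀

  module _ {δ c : ℕ} {A B : ℕ → ℤ} (S : SquareLike δ c A B) (1≤δ : 1 ≤ δ)
           (k : ℕ) (δ≤k : δ ≤ k) where
    open SquareLike S
    open Counts S 1≤δ k δ≤k

    module _ (e g : ℕ) (k≡ : δ ℕ.+ δ ℕ.+ (e ℕ.+ e ℕ.+ suc g) ≡ k) where

      private
        L : ℕ
        L = δ ℕ.+ δ ℕ.+ (e ℕ.+ e ℕ.+ 1)
        L+g≡k : L ℕ.+ g ≡ k
        L+g≡k = trans (lemma (δ ℕ.+ δ) (e ℕ.+ e) g) k≡
          where
          lemma : ∀ d e g → d ℕ.+ (e ℕ.+ 1) ℕ.+ g ≡ d ℕ.+ (e ℕ.+ suc g)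
          lemma = ℕ-Solver.solve-∀

      -- Position of the index 3^e (τ + 6t). Fixing the unit part modulo 3 selects one of the two
      -- signs, which makes the values of `B` injective in `t`.
      point : ℕ → ℕ
      point t = base e ℕ.+ 3 ℕ.^ suc e ℕ.* t

      N-point : ∀ t → N (point t) ≡ 3^ e * (τ + + 3 * (+ 2 * + t))
      N-point t = begin
        N (point t)
          ≡⟨ cong +_ (rearrange c (base e) (3 ℕ.^ e) t) ⟩
        N (base e) + + (6 ℕ.* (3 ℕ.^ e ℕ.* t))
          ≡⟨ cong₂ _+_ (N-base e) (trans (ℤ.pos-* 6 (3 ℕ.^ e ℕ.* t)) (cong (+ 6 *_) (ℤ.pos-* (3 ℕ.^ e) t))) ⟩
        τ * 3^ e + + 6 * (3^ e * + t)
          ≡⟨ lemma τ (3^ e) (+ t) ⟩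
        3^ e * (τ + + 3 * (+ 2 * + t)) ∎
        where
        open ≡-Reasoning
        rearrange : ∀ c b q t → c ℕ.+ (b ℕ.+ 3 ℕ.* q ℕ.* t) ℕ.* 2 ≡ (c ℕ.+ b ℕ.* 2) ℕ.+ 6 ℕ.* (q ℕ.* t)
        rearrange = ℕ-Solver.solve-∀
        lemma : ∀ τ q t → τ * q + + 6 * (q * t) ≡ q * (τ + + 3 * (+ 2 * t))
        lemma = solve-∀

      -- (τ + 6t)² - (τ + 6s)² = 3 (t - s) w with w ≡ 4τ modulo 3, a unit. The extra 3 accounts for
      -- the 1 in 2l + 1.
      point-difference : ∀ t s → B (point t) - B (point s) ~ 3^ L * (+ t - + s)
      point-difference t s = ~-trans (B-difference (point t) (point s)) (~-trans
          (~-reflexive eq) (unit-*-~ (3^ L * (+ t - + s)) unit))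
        where
        w : ℤ
        w = + 2 * (+ 2 * τ) + + 3 * (+ 4 * (+ t + + s))
        unit : Unit w
        unit = unit-+3* (+ 4 * (+ t + + s)) (unit-* unit-2 (unit-* unit-2 τ-unit))
        lemma : ∀ D q τ t s →
          D * ((q * (τ + + 3 * (+ 2 * t))) * (q * (τ + + 3 * (+ 2 * t)))
             - (q * (τ + + 3 * (+ 2 * s))) * (q * (τ + + 3 * (+ 2 * s))))
          ≡ (+ 2 * (+ 2 * τ) + + 3 * (+ 4 * (t + s))) * (D * (q * q * + 3) * (t - s))
        lemma = solve-∀
        eq : 3^ (δ ℕ.+ δ) * (N (point t) * N (point t) - N (point s) * N (point s)) ≡ w * (3^ L * (+ t - + s))
        eq = trans (cong₂ (λ a b → 3^ (δ ℕ.+ δ) * (a * a - b * b)) (N-point t) (N-point s))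
          (trans (lemma (3^ (δ ℕ.+ δ)) (3^ e) τ (+ t) (+ s))
            (cong (λ z → w * (z * (+ t - + s))) (sym (trans (3^-+ (δ ℕ.+ δ) (e ℕ.+ e ℕ.+ 1))
              (cong (3^ (δ ℕ.+ δ) *_) (trans (3^-+ (e ℕ.+ e) 1) (cong (_* + 3) (3^-+ e e))))))))

      module _ (b : ℤ) (b≡ : 3^ L ∣ b - B (base e)) where

        divisible : ∀ t → 3^ L ∣ B (point t) - b
        divisible t = ∣-chain (B (point t)) (B (base e)) b
          (subst (λ x → 3^ L ∣ B (point t) - B x) point-0
            (~-∣ L (~-sym (point-difference t 0)) (∣m⇒∣m*n (+ t - + 0) ∣-refl)))
          (∣-swap b (B (base e)) b≡)
          where
          point-0 : point 0 ≡ base e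
          point-0 = trans (cong (base e ℕ.+_) (ℕ.*-zeroʳ (3 ℕ.^ suc e))) (ℕ.+-identityʳ (base e))

        -- The lifting step: `b` is given only modulo `3^ L`, but the points realise every lift of
        -- that residue modulo 3^k.
        solution : ∃[ t ] (t < 3 ℕ.^ g × 3^ k ∣ B (point t) - b)
        solution = subst (λ i → ∃[ t ] (t < 3 ℕ.^ g × 3^ i ∣ B (point t) - b)) L+g≡k
          (injective⇒surjective L g (λ t → B (point t)) b divisible
            (λ t s d → 3^-*-cancel-∣ L g (~-∣ (L ℕ.+ g) (point-difference t s) d)))

        -- The preimage of `b` splits into the classes of the two roots modulo 3^M, each with
        -- 3^(K-M) = 3^(δ+e) positions.
        count-from-solution : ∀ t₁ → 3^ k ∣ B (point t₁) - b → total b ≡ 2 ℕ.* 3 ℕ.^ (δ ℕ.+ e)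
        count-from-solution t₁ hit = cong₂ ℕ._+_
            (countA-miss b (unit⇒3^δ∤ (≡B⇒unit x₁ 1≤k (∣-swap (B x₁) b hit)))) (begin
              countB b
                ≡⟨ count-cong (λ x → B x ≡? b [mod 3 ℕ.^ k ]) (λ x → Q? x ⊎-dec R? x) to from (3 ℕ.^ K) ⟩
              count (λ x → Q? x ⊎-dec R? x) (3 ℕ.^ K)
                ≡⟨ count-⊎ Q? R? (λ x q r → roots-distinct (N x) (Q⇒ x q) (R⇒ x r)) (3 ℕ.^ K) ⟩
              count Q? (3 ℕ.^ K) ℕ.+ count R? (3 ℕ.^ K)
                ≡⟨ cong₂ ℕ._+_ (class (+ x₁)) (class (- (+ x₁ + + c))) ⟩
              3 ℕ.^ (δ ℕ.+ e) ℕ.+ 3 ℕ.^ (δ ℕ.+ e)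
                ≡⟨ cong (3 ℕ.^ (δ ℕ.+ e) ℕ.+_) (ℕ.+-identityʳ (3 ℕ.^ (δ ℕ.+ e))) ⟨
              2 ℕ.* 3 ℕ.^ (δ ℕ.+ e) ∎)
          where
          open ≡-Reasoning
          x₁ : ℕ
          x₁ = point t₁
          m₁ : ℤ
          m₁ = τ + + 3 * (+ 2 * + t₁)
          open SquareRoots e g m₁ (unit-+3* (+ 2 * + t₁) τ-unit)
          M : ℕ
          M = e ℕ.+ suc g
          Q R : ℕ → Set
          Q x = 3^ M ∣ + x - + x₁
          R x = 3^ M ∣ + x - (- (+ x₁ + + c))
          Q? : ∀ x → Dec (Q x)
          Q? x = 3^ M ∣? (+ x - + x₁)
          R? : ∀ x → Dec (R x)
          R? x = 3^ M ∣? (+ x - (- (+ x₁ + + c)))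
          minus : ∀ x → N x - n₁ ≡ + 2 * (+ x - + x₁)
          minus x = trans (cong (λ z → N x - z) (sym (N-point t₁))) (N-minus x x₁)
          plus : ∀ x → N x + n₁ ≡ + 2 * (+ x - (- (+ x₁ + + c)))
          plus x = trans (cong (λ z → N x + z) (sym (N-point t₁))) (N-plus x x₁)
          Q⇒ : ∀ x → Q x → 3^ M ∣ N x - n₁
          Q⇒ x d = subst (3^ M ∣_) (sym (minus x)) (∣n⇒∣m*n (+ 2) d)
          R⇒ : ∀ x → R x → 3^ M ∣ N x + n₁
          R⇒ x d = subst (3^ M ∣_) (sym (plus x)) (∣n⇒∣m*n (+ 2) d)
          ⇒Q : ∀ x → 3^ M ∣ N x - n₁ → Q x
          ⇒Q x d = unit-cancel-∣ M unit-2 (subst (3^ M ∣_) (minus x) d)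
          ⇒R : ∀ x → 3^ M ∣ N x + n₁ → R x
          ⇒R x d = unit-cancel-∣ M unit-2 (subst (3^ M ∣_) (plus x) d)
          j : ℕ
          j = e ℕ.+ e ℕ.+ suc g
          square-∣⇒ : ∀ x → 3^ k ∣ B x - b → 3^ j ∣ N x * N x - N x₁ * N x₁
          square-∣⇒ x d = 3^-*-cancel-∣ (δ ℕ.+ δ) j
            (subst (λ i → 3^ i ∣ 3^ (δ ℕ.+ δ) * (N x * N x - N x₁ * N x₁)) (sym k≡)
              (B-∣⇒ k x x₁ (∣-chain (B x) b (B x₁) d (∣-swap (B x₁) b hit))))
          square-∣⇐ : ∀ x → 3^ j ∣ N x * N x - N x₁ * N x₁ → 3^ k ∣ B x - b
          square-∣⇐ x d = ∣-chain (B x) (B x₁) b (B-∣⇐ k x x₁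
            (subst (λ i → 3^ i ∣ 3^ (δ ℕ.+ δ) * (N x * N x - N x₁ * N x₁)) k≡
              (3^-*-mono-∣ (δ ℕ.+ δ) j d))) hit
          N-x₁ : N x₁ ≡ n₁
          N-x₁ = N-point t₁
          to : ∀ x → 3^ k ∣ B x - b → Q x ⊎ R x
          to x d = Sum.map (⇒Q x) (⇒R x)
            (roots (N x) (subst (λ z → 3^ j ∣ N x * N x - z * z) N-x₁ (square-∣⇒ x d)))
          from : ∀ x → Q x ⊎ R x → 3^ k ∣ B x - b
          from x d = square-∣⇐ x (subst (λ z → 3^ j ∣ N x * N x - z * z) (sym N-x₁)
            (roots⁻¹ (N x) (Sum.map (Q⇒ x) (R⇒ x) d)))
          K≡ : K ≡ δ ℕ.+ e ℕ.+ M
          K≡ = ℕ.+-cancelˡ-≡ δ K _ (trans δ+K≡k (trans (sym k≡) (lemma δ e (suc g))))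
            where
            lemma : ∀ δ e g → δ ℕ.+ δ ℕ.+ (e ℕ.+ e ℕ.+ g) ≡ δ ℕ.+ (δ ℕ.+ e ℕ.+ (e ℕ.+ g))
            lemma = ℕ-Solver.solve-∀
          class : ∀ r → count (λ x → 3^ M ∣? (+ x - r)) (3 ℕ.^ K) ≡ 3 ℕ.^ (δ ℕ.+ e)
          class r = trans (cong (count (λ x → 3^ M ∣? (+ x - r)))
              (trans (cong (3 ℕ.^_) K≡) (ℕ.^-distribˡ-+-* 3 (δ ℕ.+ e) M)))
            (count-residue-class (3 ℕ.^ M) {{ℕ.m^n≢0 3 M}} (3 ℕ.^ (δ ℕ.+ e)) r)

        total-unit-class : total b ≡ 2 ℕ.* 3 ℕ.^ (δ ℕ.+ e)
        total-unit-class = conclude solution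
          where
          conclude : ∃[ t ] (t < 3 ℕ.^ g × 3^ k ∣ B (point t) - b) → total b ≡ 2 ℕ.* 3 ℕ.^ (δ ℕ.+ e)
          conclude (t , _ , hit) = count-from-solution t hit

    private
      exponent : ∀ δ e → 2 ℕ.* (δ ℕ.+ e) ℕ.+ 1 ≡ δ ℕ.+ δ ℕ.+ (e ℕ.+ e ℕ.+ 1)
      exponent = ℕ-Solver.solve-∀

      exponent-suc : ∀ δ e g → δ ℕ.+ δ ℕ.+ (e ℕ.+ e ℕ.+ suc g) ≡ 2 ℕ.* (δ ℕ.+ e) ℕ.+ 1 ℕ.+ g
      exponent-suc = ℕ-Solver.solve-∀

      total-unit′ : ∀ b l e g → δ ℕ.+ e ≡ l → 2 ℕ.* l ℕ.+ 1 ℕ.+ g ≡ k →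
        3^ (2 ℕ.* l ℕ.+ 1) ∣ b - B (base e) → total b ≡ 2 ℕ.* 3 ℕ.^ l
      total-unit′ b _ e g refl k≡ b≡ = total-unit-class e g (trans (exponent-suc δ e g) k≡) b
        (subst (λ i → 3^ i ∣ b - B (base e)) (exponent δ e) b≡)

    total-unit : ∀ b l → δ ≤ l → l ≤ (k ℕ.∸ 1) ℕ./ 2 →
      3^ (2 ℕ.* l ℕ.+ 1) ∣ b - B (base (l ℕ.∸ δ)) → total b ≡ 2 ℕ.* 3 ℕ.^ l
    total-unit b l δ≤l l≤ = total-unit′ b l (l ℕ.∸ δ) (k ℕ.∸ (2 ℕ.* l ℕ.+ 1))
      (ℕ.m+[n∸m]≡n δ≤l) (ℕ.m+[n∸m]≡n 2l+1≤k)
      where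
      open ℕ.≤-Reasoning
      2l+1≤k : 2 ℕ.* l ℕ.+ 1 ≤ k
      2l+1≤k = begin
        2 ℕ.* l ℕ.+ 1                  ≡⟨ ℕ.+-comm (2 ℕ.* l) 1 ⟩
        suc (2 ℕ.* l)                  ≡⟨ cong suc (ℕ.*-comm 2 l) ⟩
        suc (l ℕ.* 2)                  ≤⟨ s≤s (ℕ.*-monoˡ-≤ 2 l≤) ⟩
        suc ((k ℕ.∸ 1) ℕ./ 2 ℕ.* 2)    ≤⟨ s≤s (ℕ.m/n*n≤m (k ℕ.∸ 1) 2) ⟩
        suc (k ℕ.∸ 1)                  ≡⟨ ℕ.m+[n∸m]≡n 1≤k ⟩
        k                              ∎

-- Shortest periods, and the counts for u and v themselves

module Assembly where
  open import Data.Integer.Base using (-_; _+_; _*_; _-_)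
  open ThreeAdic
  open Counting
  open Distribution

  -- Steps go upwards only; negating both sides handles `x ≤ y`.
  from-steps : (F : ℕ → ℤ) (G : ℕ → ℕ → ℤ) → (∀ x y → - G x y ≡ G y x) →
    (∀ x b → F (x ℕ.+ b) - F x ~ G (x ℕ.+ b) x) → ∀ x y → F x - F y ~ G x y
  from-steps F G antisym step x y with ℕ.≤-total y x
  ... | inj₁ y≤x = subst (λ z → F z - F y ~ G z y) (ℕ.m+[n∸m]≡n y≤x) (step y (x ℕ.∸ y))
  ... | inj₂ x≤y = subst₂ _~_ (lemma (F y) (F x)) (antisym y x)
        (~-neg (subst (λ z → F z - F x ~ G z x) (ℕ.m+[n∸m]≡n x≤y) (step x (y ℕ.∸ x))))
    where
    lemma : ∀ a b → - (a - b) ≡ b - a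
    lemma = solve-∀

  exact-power~ : ∀ {P} δ → 3 ^ δ ∥ P → P ~ 3^ δ
  exact-power~ {P} δ (divides q eq , ¬d) = ~-trans (~-reflexive eq) (unit-*-~ (3^ δ) q-unit)
    where
    q-unit : Unit q
    q-unit (divides r eq′) = ¬d (divides r (trans eq (trans (cong (_* 3^ δ) eq′)
      (trans (ℤ.*-assoc r (+ 3) (3^ δ)) (cong (r *_) (sym (3^-suc δ)))))))

  -- A period 2g shifts each half by g, which forces `M` to divide g; an odd period would exchange
  -- the halves.
  period-length : ∀ (s : ℕ → ℤ) m .{{_ : NonZero m}} M → 0 < M → ∀ h → IsShortestPeriod s m h →
    (∀ x → s ((x ℕ.+ M) ℕ.* 2) ≡ s (x ℕ.* 2) [mod m ]) →
    (∀ x → s (suc ((x ℕ.+ M) ℕ.* 2)) ≡ s (suc (x ℕ.* 2)) [mod m ]) →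
    (∀ g → IsPeriod s m (g ℕ.* 2) → + M ∣ + g) →
    (∀ d → ¬ IsPeriod s m (suc (d ℕ.* 2))) → h ≡ M ℕ.* 2
  period-length s m M 0<M h shortest even odd ∣g ¬odd =
    ℕ.≤-antisym (minimal (M ℕ.* 2) (ℕ.*-monoˡ-< 2 0<M) period) (2M≤ h positive isPeriod)
    where
    open IsShortestPeriod shortest
    period : IsPeriod s m (M ℕ.* 2)
    period n with parity n
    ... | c , inj₁ refl = subst (λ i → s i ≡ s (c ℕ.* 2) [mod m ]) (ℕ.*-distribʳ-+ 2 c M) (even c)
    ... | c , inj₂ refl = subst (λ i → s (suc i) ≡ s (suc (c ℕ.* 2)) [mod m ]) (ℕ.*-distribʳ-+ 2 c M) (odd c)
    2M≤ : ∀ h → 0 < h → IsPeriod s m h → M ℕ.* 2 ≤ h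
    2M≤ h 0<h per with parity h
    ... | g     , inj₂ refl = contradiction per (¬odd g)
    ... | suc g , inj₁ refl = ℕ.*-monoˡ-≤ 2 (ℕ.∣⇒≤ (∣⇒∣ᵤ (∣g (suc g) per)))
    2M≤ h () per | zero , inj₁ refl

  -- Abstracting the representatives and the count lets u and v share one proof, after which `subst`
  -- turns `total` into the counting function.
  LargeDistribution : (δ k : ℕ) → ℤ → ℤ → (ℕ → ℤ) → ℕ → Set
  LargeDistribution δ k b first second ν =
      (b ≡ first [mod 3 ℕ.^ k ] → ν ≡ 3 ℕ.^ (k ℕ./ 2))
    × ((l : ℕ) → δ ≤ l → l ≤ (k ℕ.∸ 1) ℕ./ 2 →
         b ≡ second (l ℕ.∸ δ) [mod 3 ℕ.^ (2 ℕ.* l ℕ.+ 1) ] → ν ≡ 2 ℕ.* 3 ℕ.^ l)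
    × (b ≡ + 0 [mod 3 ℕ.^ δ ] → ν ≡ 1)
    × (¬ (b ≡ first [mod 3 ℕ.^ k ])
       → ¬ (∃[ l ] (δ ≤ l × l ≤ (k ℕ.∸ 1) ℕ./ 2 ×
                    b ≡ second (l ℕ.∸ δ) [mod 3 ℕ.^ (2 ℕ.* l ℕ.+ 1) ]))
       → ¬ (b ≡ + 0 [mod 3 ℕ.^ δ ])
       → ν ≡ 0)

  SmallDistribution : (δ k : ℕ) → ℤ → ℤ → ℕ → Set
  SmallDistribution δ k b first ν =
      (b ≡ first [mod 3 ℕ.^ k ] → ν ≡ 3 ℕ.^ (k ℕ.∸ δ))
    × (b ≡ + 0 [mod 3 ℕ.^ δ ] → ν ≡ 1)
    × (¬ (b ≡ first [mod 3 ℕ.^ k ]) → ¬ (b ≡ + 0 [mod 3 ℕ.^ δ ]) → ν ≡ 0)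

  minus-0 : ∀ M b → M ∣ b - + 0 → M ∣ b
  minus-0 M b = subst (M ∣_) (ℤ.+-identityʳ b)

  minus-0⁻¹ : ∀ M b → M ∣ b → M ∣ b - + 0
  minus-0⁻¹ M b = subst (M ∣_) (sym (ℤ.+-identityʳ b))

  module _ {δ c : ℕ} {A B : ℕ → ℤ} (S : SquareLike δ c A B) (1≤δ : 1 ≤ δ)
           (k : ℕ) (δ≤k : δ ≤ k) where
    open SquareLike S
    open Counts S 1≤δ k δ≤k

    large-distribution : (2δ∸1≤k : 2 ℕ.* δ ℕ.∸ 1 ≤ k) (second : ℕ → ℤ) →
      (∀ e → B (base e) ≡ second e) → ∀ x₀ → 3^ (Large.f 2δ∸1≤k) ∣ N x₀ →
      ∀ b → LargeDistribution δ k b (B x₀) second (total b)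
    large-distribution 2δ∸1≤k second second≡ x₀ d₀ b =
        total-vanishing b x₀ d₀
      , (λ l δ≤l l≤ d → total-unit S 1≤δ k δ≤k b l δ≤l l≤ (to l d))
      , (λ d → total-divisible b (minus-0 (3^ δ) b d))
      , (λ ¬first ¬second ¬0 → total-miss b x₀ d₀ ¬first
           (λ (l , δ≤l , l≤ , d) → ¬second (l , δ≤l , l≤ , from l d))
           (λ d → ¬0 (minus-0⁻¹ (3^ δ) b d)))
      where
      open Large 2δ∸1≤k
      to : ∀ l → 3^ (2 ℕ.* l ℕ.+ 1) ∣ b - second (l ℕ.∸ δ) → 3^ (2 ℕ.* l ℕ.+ 1) ∣ b - B (base (l ℕ.∸ δ))
      to l = subst (λ z → 3^ (2 ℕ.* l ℕ.+ 1) ∣ b - z) (sym (second≡ (l ℕ.∸ δ)))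
      from : ∀ l → 3^ (2 ℕ.* l ℕ.+ 1) ∣ b - B (base (l ℕ.∸ δ)) → 3^ (2 ℕ.* l ℕ.+ 1) ∣ b - second (l ℕ.∸ δ)
      from l = subst (λ z → 3^ (2 ℕ.* l ℕ.+ 1) ∣ b - z) (second≡ (l ℕ.∸ δ))

    small-distribution : k ≤ δ ℕ.+ δ → ∀ x₀ b → SmallDistribution δ k b (B x₀) (total b)
    small-distribution k≤2δ x₀ b =
        total-small k≤2δ b x₀
      , (λ d → total-divisible b (minus-0 (3^ δ) b d))
      , (λ ¬first ¬0 → total-small-miss k≤2δ b x₀ ¬first (λ d → ¬0 (minus-0⁻¹ (3^ δ) b d)))

    -- By `B-vanishing`, every index divisible by 3^f gives the same residue, so the exponent in the
    -- statement only has to reach f. With j = k + 1 - 2δ, f is at most j/2, which is less than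
    -- 2⌊j/4⌋ + 2.
    f≤exponent : (2δ∸1≤k : 2 ℕ.* δ ℕ.∸ 1 ≤ k) →
      Large.f 2δ∸1≤k ≤ 2 ℕ.* ((k ℕ.+ 1 ℕ.∸ 2 ℕ.* δ) ℕ./ 4) ℕ.+ 1
    f≤exponent 2δ∸1≤k = ℕ.≤-pred (ℕ.*-cancelʳ-< 2 f (suc (2 ℕ.* q ℕ.+ 1)) (begin-strict
        f ℕ.* 2                   ≡⟨ ℕ.m+n∸m≡n (2 ℕ.* δ) (f ℕ.* 2) ⟨
        2 ℕ.* δ ℕ.+ f ℕ.* 2 ℕ.∸ 2 ℕ.* δ ≡⟨ cong (ℕ._∸ 2 ℕ.* δ) (rearrange δ f) ⟩
        (δ ℕ.+ f) ℕ.+ (δ ℕ.+ f) ℕ.∸ 2 ℕ.* δ ≡⟨ cong (λ F → F ℕ.+ F ℕ.∸ 2 ℕ.* δ) δ+f≡F ⟩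
        F ℕ.+ F ℕ.∸ 2 ℕ.* δ       ≤⟨ ℕ.∸-monoˡ-≤ (2 ℕ.* δ) F+F≤1+k ⟩
        suc k ℕ.∸ 2 ℕ.* δ         ≡⟨ cong (ℕ._∸ 2 ℕ.* δ) (ℕ.+-comm 1 k) ⟩
        j                         ≡⟨ ℕ.m≡m%n+[m/n]*n j 4 ⟩
        j ℕ.% 4 ℕ.+ q ℕ.* 4       <⟨ ℕ.+-monoˡ-< (q ℕ.* 4) (ℕ.m%n<n j 4) ⟩
        4 ℕ.+ q ℕ.* 4             ≡⟨ rearrange′ q ⟩
        suc (2 ℕ.* q ℕ.+ 1) ℕ.* 2 ∎))
      where
      open Large 2δ∸1≤k
      open ℕ.≤-Reasoning
      j q : ℕ
      j = k ℕ.+ 1 ℕ.∸ 2 ℕ.* δ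
      q = j ℕ./ 4
      rearrange : ∀ δ f → 2 ℕ.* δ ℕ.+ f ℕ.* 2 ≡ (δ ℕ.+ f) ℕ.+ (δ ℕ.+ f)
      rearrange = ℕ-Solver.solve-∀
      rearrange′ : ∀ q → 4 ℕ.+ q ℕ.* 4 ≡ suc (2 ℕ.* q ℕ.+ 1) ℕ.* 2
      rearrange′ = ℕ-Solver.solve-∀

  -- (3^e - 1)/2, the position of 3^e among the odd numbers.
  half : ℕ → ℕ
  half zero    = 0
  half (suc e) = suc (half e ℕ.* 3)

  half-correct : ∀ e → suc (half e ℕ.* 2) ≡ 3 ℕ.^ e
  half-correct zero    = refl
  half-correct (suc e) = trans (lemma (half e)) (cong (3 ℕ.*_) (half-correct e))
    where
    lemma : ∀ h → suc (suc (h ℕ.* 3) ℕ.* 2) ≡ 3 ℕ.* suc (h ℕ.* 2)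
    lemma = ℕ-Solver.solve-∀

  module _ (P : ℤ) (3∣P : + 3 ∣ P) (δ : ℕ) (1≤δ : 1 ≤ δ) (3^δ∥P : 3 ^ δ ∥ P) where
    open Lucas P
    open DivisibleBy3 3∣P

    private
      P~3^δ : P ~ 3^ δ
      P~3^δ = exact-power~ δ 3^δ∥P

      double-step : ∀ x b → x ℕ.* 2 ℕ.+ b ℕ.+ b ≡ (x ℕ.+ b) ℕ.* 2
      double-step = ℕ-Solver.solve-∀

      linear : (F : ℕ → ℤ) → (∀ x b → F (x ℕ.+ b) - F x ~ P * + b) →
        ∀ x y → F x - F y ~ 3^ δ * (+ x - + y)
      linear F step = from-steps F (λ x y → 3^ δ * (+ x - + y)) (λ x y → lemma₁ (3^ δ) (+ x) (+ y))
        (λ x b → ~-trans (step x b) (~-* P~3^δ (~-reflexive (lemma₂ (+ x) (+ b)))))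
        where
        lemma₁ : ∀ t x y → - (t * (x - y)) ≡ t * (y - x)
        lemma₁ = solve-∀
        lemma₂ : ∀ x b → b ≡ (x + b) - x
        lemma₂ = solve-∀

      -- (n + 2b)² - n² = 4 (n + b) b, and 4 is a unit.
      quadratic : (c : ℕ) (F : ℕ → ℤ) →
        (∀ x b → F (x ℕ.+ b) - F x ~ P * + (c ℕ.+ x ℕ.* 2 ℕ.+ b) * (P * + b)) →
        ∀ x y → F x - F y ~ 3^ (δ ℕ.+ δ) *
          (+ (c ℕ.+ x ℕ.* 2) * + (c ℕ.+ x ℕ.* 2) - + (c ℕ.+ y ℕ.* 2) * + (c ℕ.+ y ℕ.* 2))
      quadratic c F step = from-steps F G (λ x y → lemma₁ (3^ (δ ℕ.+ δ)) (N x) (N y))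
        (λ x b → ~-trans (step x b) (~-trans
          (~-* (~-* P~3^δ (~-refl {N x + + b})) (~-* P~3^δ (~-refl {+ b})))
          (~-trans (~-sym (unit-*-~ (3^ δ * (N x + + b) * (3^ δ * + b)) (unit-* unit-2 unit-2)))
            (~-reflexive (sym (G-step x b))))))
        where
        N : ℕ → ℤ
        N x = + (c ℕ.+ x ℕ.* 2)
        G : ℕ → ℕ → ℤ
        G x y = 3^ (δ ℕ.+ δ) * (N x * N x - N y * N y)
        lemma₁ : ∀ t x y → - (t * (x * x - y * y)) ≡ t * (y * y - x * x)
        lemma₁ = solve-∀
        N-step : ∀ x b → N (x ℕ.+ b) ≡ N x + + b + + b
        N-step x b = cong +_ (lemma c x b)
          where
          lemma : ∀ c x b → c ℕ.+ (x ℕ.+ b) ℕ.* 2 ≡ c ℕ.+ x ℕ.* 2 ℕ.+ b ℕ.+ b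
          lemma = ℕ-Solver.solve-∀
        lemma₂ : ∀ t n b → t * t * ((n + b + b) * (n + b + b) - n * n)
                         ≡ + 2 * + 2 * (t * (n + b) * (t * b))
        lemma₂ = solve-∀
        G-step : ∀ x b → G (x ℕ.+ b) x ≡ + 2 * + 2 * (3^ δ * (N x + + b) * (3^ δ * + b))
        G-step x b = trans (cong₂ (λ t n → t * (n * n - N x * N x)) (3^-+ δ δ) (N-step x b))
          (lemma₂ (3^ δ) (N x) (+ b))

      3^δ∣P : 3^ δ ∣ P
      3^δ∣P = proj₁ 3^δ∥P

    u-squareLike : SquareLike δ 1 (λ x → u P (x ℕ.* 2)) (λ x → u P (suc (x ℕ.* 2)))
    u-squareLike = record
      { A-difference = linear (λ x → u P (x ℕ.* 2)) λ x b →
          subst (λ i → u P i - u P (x ℕ.* 2) ~ P * + b) (double-step x b) (u-even-step~ x b)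
      ; A-divisible  = λ x → ∣-trans 3^δ∣P (P∣u-even x)
      ; B-difference = quadratic 1 (λ x → u P (suc (x ℕ.* 2))) λ x b →
          subst (λ i → u P (suc i) - u P (suc (x ℕ.* 2)) ~ P * + (suc (x ℕ.* 2) ℕ.+ b) * (P * + b))
            (double-step x b) (u-odd-step~ x b)
      ; B-unit       = λ x → u-odd-unit _ x refl
      ; base         = half
      ; τ            = + 1
      ; τ-unit       = unit-1
      ; N-base       = λ e → trans (cong +_ (half-correct e)) (sym (ℤ.*-identityˡ (3^ e)))
      }

    v-squareLike : SquareLike δ 0 (λ x → v P (suc (x ℕ.* 2))) (λ x → v P (x ℕ.* 2))
    v-squareLike = record
      { A-difference = linear (λ x → v P (suc (x ℕ.* 2))) λ x b →
          subst (λ i → v P (suc i) - v P (suc (x ℕ.* 2)) ~ P * + b) (double-step x b) (v-odd-step~ x b)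
      ; A-divisible  = λ x → ∣-trans 3^δ∣P (P∣v-odd x)
      ; B-difference = quadratic 0 (λ x → v P (x ℕ.* 2)) λ x b →
          subst (λ i → v P i - v P (x ℕ.* 2) ~ P * + (x ℕ.* 2 ℕ.+ b) * (P * + b))
            (double-step x b) (v-even-step~ x b)
      ; B-unit       = λ x → v-even-unit _ x refl
      ; base         = 3 ℕ.^_
      ; τ            = + 2
      ; τ-unit       = unit-2
      ; N-base       = λ e → trans (ℤ.pos-* (3 ℕ.^ e) 2) (ℤ.*-comm (3^ e) (+ 2))
      }

    module _ (k : ℕ) (δ≤k : δ ≤ k) where
      private
        module CU = Counts u-squareLike 1≤δ k δ≤k
        module CV = Counts v-squareLike 1≤δ k δ≤k
        instance
          3^k≢0 : NonZero (3 ℕ.^ k)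
          3^k≢0 = ℕ.m^n≢0 3 k

      private
        not-both : ∀ a b → + 3 ∣ a → Unit b → ¬ (+ 3 ∣ b - a)
        not-both a b 3∣a ub d = ub (subst (+ 3 ∣_) (lemma b a) (∣m∣n⇒∣m+n d 3∣a))
          where
          lemma : ∀ b a → (b - a) + a ≡ b
          lemma = solve-∀

      hᵤ-value : hᵤ P (3 ℕ.^ k) ≡ 3 ℕ.^ (k ℕ.∸ δ) ℕ.* 2
      hᵤ-value = period-length (u P) (3 ℕ.^ k) (3 ℕ.^ (k ℕ.∸ δ)) (ℕ.m^n>0 3 (k ℕ.∸ δ))
        (hᵤ P (3 ℕ.^ k)) (hᵤ-isShortestPeriod P (3 ℕ.^ k)) CU.A-period CU.B-period
        (λ g per → minus-0 (3^ (k ℕ.∸ δ)) (+ g) (CU.A-∣⇒ g 0 (per 0)))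
        (λ d per → not-both (+ 0) (u P (suc (d ℕ.* 2))) (divides (+ 0) refl) (u-odd-unit _ d refl)
          (∣-trans (CU.3∣3^ CU.1≤k) (per 0)))

      hᵥ-value : hᵥ P (3 ℕ.^ k) ≡ 3 ℕ.^ (k ℕ.∸ δ) ℕ.* 2
      hᵥ-value = period-length (v P) (3 ℕ.^ k) (3 ℕ.^ (k ℕ.∸ δ)) (ℕ.m^n>0 3 (k ℕ.∸ δ))
        (hᵥ P (3 ℕ.^ k)) (hᵥ-isShortestPeriod P (3 ℕ.^ k)) CV.B-period CV.A-period
        -- The linear half of v lives on odd indices, so the period is tested at index 1, its
        -- position 0.
        (λ g per → minus-0 (3^ (k ℕ.∸ δ)) (+ g) (CV.A-∣⇒ g 0 (per 1)))
        (λ d per → not-both (v P (suc (d ℕ.* 2))) (+ 2) (∣-trans 3∣P (P∣v-odd d)) unit-2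
          (∣-swap (v P (suc (d ℕ.* 2))) (+ 2) (∣-trans (CV.3∣3^ CV.1≤k) (per 0))))

      νᵤ-total : ∀ b → CU.total b ≡ νᵤ P (3 ℕ.^ k) b
      νᵤ-total b = sym (trans (length-filter-applyUpTo (λ n → u P n ≡? b [mod 3 ℕ.^ k ]) (λ n → n) (hᵤ P (3 ℕ.^ k)))
        (trans (cong (count (λ n → u P n ≡? b [mod 3 ℕ.^ k ])) hᵤ-value)
          (count-parity (λ n → u P n ≡? b [mod 3 ℕ.^ k ]) (3 ℕ.^ (k ℕ.∸ δ)))))

      νᵥ-total : ∀ b → CV.total b ≡ νᵥ P (3 ℕ.^ k) b
      νᵥ-total b = sym (trans (length-filter-applyUpTo (λ n → v P n ≡? b [mod 3 ℕ.^ k ]) (λ n → n) (hᵥ P (3 ℕ.^ k)))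
        (trans (cong (count (λ n → v P n ≡? b [mod 3 ℕ.^ k ])) hᵥ-value)
          (trans (count-parity (λ n → v P n ≡? b [mod 3 ℕ.^ k ]) (3 ℕ.^ (k ℕ.∸ δ)))
            (ℕ.+-comm (CV.countB b) (CV.countA b)))))

      νᵤ-large : 2 ℕ.* δ ℕ.∸ 1 ≤ k → ∀ b → LargeDistribution δ k b
        (u P (3 ℕ.^ (2 ℕ.* ((k ℕ.+ 1 ℕ.∸ 2 ℕ.* δ) ℕ./ 4) ℕ.+ 1))) (λ e → u P (3 ℕ.^ e)) (νᵤ P (3 ℕ.^ k) b)
      νᵤ-large 2δ∸1≤k b = subst₂ (λ z → LargeDistribution δ k b z (λ e → u P (3 ℕ.^ e)))
        (cong (u P) (half-correct e₀)) (νᵤ-total b)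
        (large-distribution u-squareLike 1≤δ k δ≤k 2δ∸1≤k (λ e → u P (3 ℕ.^ e))
          (λ e → cong (u P) (half-correct e)) (half e₀)
          (subst (λ n → 3^ f ∣ + n) (sym (half-correct e₀))
            (3^-mono-∣ (f≤exponent u-squareLike 1≤δ k δ≤k 2δ∸1≤k))) b)
        where
        e₀ f : ℕ
        e₀ = 2 ℕ.* ((k ℕ.+ 1 ℕ.∸ 2 ℕ.* δ) ℕ./ 4) ℕ.+ 1
        f = CU.Large.f 2δ∸1≤k

      -- Index 0 is even and divisible by every power of 3, so v_0 = 2 represents the vanishing
      -- class. Odd indices offer no 0, which is why u needs a high power of 3 instead.
      νᵥ-large : 2 ℕ.* δ ℕ.∸ 1 ≤ k → ∀ b → LargeDistribution δ k b
        (+ 2) (λ e → v P (2 ℕ.* 3 ℕ.^ e)) (νᵥ P (3 ℕ.^ k) b)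
      νᵥ-large 2δ∸1≤k b = subst (LargeDistribution δ k b (+ 2) (λ e → v P (2 ℕ.* 3 ℕ.^ e))) (νᵥ-total b)
        (large-distribution v-squareLike 1≤δ k δ≤k 2δ∸1≤k (λ e → v P (2 ℕ.* 3 ℕ.^ e))
          (λ e → cong (v P) (ℕ.*-comm (3 ℕ.^ e) 2)) 0 (divides (+ 0) refl) b)

      -- The quadratic half is constant modulo 3^k, so its first term represents it: u_1 = 1 here,
      -- v_0 = 2 for the other sequence.
      νᵤ-small : k ≤ δ ℕ.+ δ → ∀ b → SmallDistribution δ k b (+ 1) (νᵤ P (3 ℕ.^ k) b)
      νᵤ-small k≤2δ b = subst (SmallDistribution δ k b (+ 1)) (νᵤ-total b)
        (small-distribution u-squareLike 1≤δ k δ≤k k≤2δ 0 b)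

      νᵥ-small : k ≤ δ ℕ.+ δ → ∀ b → SmallDistribution δ k b (+ 2) (νᵥ P (3 ℕ.^ k) b)
      νᵥ-small k≤2δ b = subst (SmallDistribution δ k b (+ 2)) (νᵥ-total b)
        (small-distribution v-squareLike 1≤δ k δ≤k k≤2δ 0 b)

  δ≤2δ∸1 : ∀ {δ} → 1 ≤ δ → δ ≤ 2 ℕ.* δ ℕ.∸ 1
  δ≤2δ∸1 {suc d} _ = ℕ.≤-trans (ℕ.m≤m+n (suc d) 0) (ℕ.m≤n+m (suc d ℕ.+ 0) d)

  <2δ∸1⇒≤δ+δ : ∀ {k} δ → k < 2 ℕ.* δ ℕ.∸ 1 → k ≤ δ ℕ.+ δ
  <2δ∸1⇒≤δ+δ {k} δ k< = subst (k ≤_) (cong (δ ℕ.+_) (ℕ.+-identityʳ δ))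
    (ℕ.≤-trans (ℕ.<⇒≤ k<) (ℕ.m∸n≤m (2 ℕ.* δ) 1))

open import Data.Nat using (_+_; _*_; _∸_; _^_; _/_)
open import Data.Nat.Properties using (m^n≢0)
open Assembly

theorem2 : (P : ℤ) → + 3 ∣ P → (δ : ℕ) → 1 ≤ δ → 3 ^ δ ∥ P →
    ((k : ℕ) → 1 ≤ k → 2 * δ ∸ 1 ≤ k → (b : ℤ) → let instance _ = m^n≢0 3 k in
    ((b ≡ u P (3 ^ (2 * ((k + 1 ∸ 2 * δ) / 4) + 1)) [mod 3 ^ k ] → νᵤ P (3 ^ k) b ≡ 3 ^ (k / 2))
    × ((l : ℕ) → δ ≤ l → l ≤ (k ∸ 1) / 2 → b ≡ u P (3 ^ (l ∸ δ)) [mod 3 ^ (2 * l + 1) ] → νᵤ P (3 ^ k) b ≡ 2 * 3 ^ l)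
    × (b ≡ + 0 [mod 3 ^ δ ] → νᵤ P (3 ^ k) b ≡ 1)
    × (¬ (b ≡ u P (3 ^ (2 * ((k + 1 ∸ 2 * δ) / 4) + 1)) [mod 3 ^ k ])
    → ¬ (∃[ l ] (δ ≤ l × l ≤ (k ∸ 1) / 2 × b ≡ u P (3 ^ (l ∸ δ)) [mod 3 ^ (2 * l + 1) ]))
    → ¬ (b ≡ + 0 [mod 3 ^ δ ])
    → νᵤ P (3 ^ k) b ≡ 0))
    × ((b ≡ + 2 [mod 3 ^ k ] → νᵥ P (3 ^ k) b ≡ 3 ^ (k / 2))
    × ((l : ℕ) → δ ≤ l → l ≤ (k ∸ 1) / 2 → b ≡ v P (2 * 3 ^ (l ∸ δ)) [mod 3 ^ (2 * l + 1) ] → νᵥ P (3 ^ k) b ≡ 2 * 3 ^ l)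
    × (b ≡ + 0 [mod 3 ^ δ ] → νᵥ P (3 ^ k) b ≡ 1)
    × (¬ (b ≡ + 2 [mod 3 ^ k ])
    → ¬ (∃[ l ] (δ ≤ l × l ≤ (k ∸ 1) / 2 × b ≡ v P (2 * 3 ^ (l ∸ δ)) [mod 3 ^ (2 * l + 1) ]))
    → ¬ (b ≡ + 0 [mod 3 ^ δ ])
    → νᵥ P (3 ^ k) b ≡ 0)))
    × (2 ≤ δ → (k : ℕ) → 1 ≤ k → δ ≤ k → k < 2 * δ ∸ 1 → (b : ℤ) → let instance _ = m^n≢0 3 k in
    ((b ≡ + 1 [mod 3 ^ k ] → νᵤ P (3 ^ k) b ≡ 3 ^ (k ∸ δ))
    × (b ≡ + 0 [mod 3 ^ δ ] → νᵤ P (3 ^ k) b ≡ 1)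
    × (¬ (b ≡ + 1 [mod 3 ^ k ]) → ¬ (b ≡ + 0 [mod 3 ^ δ ]) → νᵤ P (3 ^ k) b ≡ 0))
    × ((b ≡ + 2 [mod 3 ^ k ] → νᵥ P (3 ^ k) b ≡ 3 ^ (k ∸ δ))
    × (b ≡ + 0 [mod 3 ^ δ ] → νᵥ P (3 ^ k) b ≡ 1)
    × (¬ (b ≡ + 2 [mod 3 ^ k ]) → ¬ (b ≡ + 0 [mod 3 ^ δ ]) → νᵥ P (3 ^ k) b ≡ 0)))
theorem2 P 3∣P δ 1≤δ 3^δ∥P =
    (λ k _ 2δ∸1≤k b → let δ≤k = ℕ.≤-trans (δ≤2δ∸1 1≤δ) 2δ∸1≤k in
        νᵤ-large P 3∣P δ 1≤δ 3^δ∥P k δ≤k 2δ∸1≤k b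
      , νᵥ-large P 3∣P δ 1≤δ 3^δ∥P k δ≤k 2δ∸1≤k b)
  , (λ _ k _ δ≤k k<2δ∸1 b → let k≤2δ = <2δ∸1⇒≤δ+δ δ k<2δ∸1 in
        νᵤ-small P 3∣P δ 1≤δ 3^δ∥P k δ≤k k≤2δ b
      , νᵥ-small P 3∣P δ 1≤δ 3^δ∥P k δ≤k k≤2δ b)
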